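{- Let $r,d$ be fixed positive integers. For all large enough $n$ we have $$t(n,d,r) \geq \frac{n}{r}-o(n)\qquad (n\to\infty),$$ that is, for every $\varepsilon>0$ there is $n_0$ such that $t(n,d,r)\ge \frac nr-\varepsilon n$ for all $n\ge n_0$.
   Context: For a finite set $X\subset\mathbb{R}^d$, the tolerance $t(X,r)$ is the maximum integer $t\ge 0$ for which there is a partition $A_1,\dots,A_r$ of $X$ such that $\bigcap_{i=1}^r\operatorname{conv}(A_i\setminus Y)\ne\emptyset$ for every $Y\subset X$ with at most $t$ points. (By Tverberg's theorem this is defined whenever $|X|\ge (d+1)(r-1)+1$.) Then $$t(n,d,r)=\min_{X\subset\mathbb{R}^d,\ |X|=n} t(X,r).$$ -}

module Defs where

open import Algebra.Bundles using (module CommutativeMonoid)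
open import Data.Nat as ℕ using (ℕ)
open import Data.Nat.Properties as ℕ using ()
open import Data.Integer using (+_)
open import Data.Rational
open import Data.Rational.Properties
open import Algebra.Properties.CommutativeSemigroup (CommutativeMonoid.commutativeSemigroup +-0-commutativeMonoid) using (interchange)
open import Data.Fin using (Fin)
open import Data.Fin.Subset using (Subset; _∈_; _∉_; _─_) renaming (∣_∣ to card)
open import Data.Product using (Σ-syntax; ∃-syntax; _×_; _,_)
open import Data.Vec.Functional using (foldr)
open import Relation.Binary.PropositionalEquality using (_≡_; sym; trans; cong; cong₂; subst)

-- The real numbers, as Cauchy sequences of rationals up to _≈ᴿ_.

Eventually : (ℕ → Set) → Set
Eventually P = ∃[ N ] (∀ n → N ℕ.≤ n → P n)

IsCauchy : (ℕ → ℚ) → Set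
IsCauchy a = ∀ ε → 0ℚ < ε →
  ∃[ N ] (∀ m n → N ℕ.≤ m → N ℕ.≤ n → ∣ a m - a n ∣ < ε)

record ℝ : Set where
  constructor mkℝ
  field
    seq    : ℕ → ℚ
    cauchy : IsCauchy seq
open ℝ public

infix  4 _≈ᴿ_ _≤ᴿ_ _<ᴿ_
infixl 6 _+ᴿ_ _-ᴿ_
infixl 7 _*ᴿ_
infix  8 -ᴿ_

_≈ᴿ_ : ℝ → ℝ → Set
x ≈ᴿ y = ∀ ε → 0ℚ < ε → Eventually λ n → ∣ seq x n - seq y n ∣ < ε

_≤ᴿ_ : ℝ → ℝ → Set
x ≤ᴿ y = ∀ ε → 0ℚ < ε → Eventually λ n → seq x n < seq y n + ε

_<ᴿ_ : ℝ → ℝ → Set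
x <ᴿ y = ∃[ δ ] 0ℚ < δ × Eventually λ n → seq x n + δ < seq y n

private abstract
  const-cauchy : ∀ q → IsCauchy (λ _ → q)
  const-cauchy q ε 0<ε = 0 , λ _ _ _ _ →
    subst (_< ε) (sym (cong ∣_∣ (+-inverseʳ q))) 0<ε

fromℚ : ℚ → ℝ
fromℚ q = mkℝ (λ _ → q) (const-cauchy q)

fromℕ : ℕ → ℝ
fromℕ n = fromℚ (+ n / 1)

0ᴿ 1ᴿ : ℝ
0ᴿ = fromℚ 0ℚ
1ᴿ = fromℚ 1ℚ

private
  cancel : ∀ x y → (x - y) + y ≡ x
  cancel x y = trans (+-assoc x (- y) y) (trans (cong (_+_ x) (+-inverseˡ y)) (+-identityʳ x))

  telescope : ∀ x y z → (x - y) + (y - z) ≡ x - z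
  telescope x y z = trans (sym (+-assoc (x - y) y (- z))) (cong (_- z) (cancel x y))

  *-distrib-- : ∀ x y z → x * (y - z) ≡ x * y - x * z
  *-distrib-- x y z = trans (*-distribˡ-+ x y (- z)) (cong (_+_ (x * y)) (sym (neg-distribʳ-* x z)))

  +-differences : ∀ x y z w → (x + y) - (z + w) ≡ (x - z) + (y - w)
  +-differences x y z w = trans (cong (_+_ (x + y)) (neg-distrib-+ z w)) (interchange x y (- z) (- w))

  *-differences : ∀ x y z w → x * y - z * w ≡ x * (y - w) + w * (x - z)
  *-differences x y z w = sym (trans
    (cong₂ _+_ (*-distrib-- x y w) (trans (*-distrib-- w x z) (cong₂ _-_ (*-comm w x) (*-comm w z))))
    (telescope (x * y) (x * w) (z * w)))

  ½+½ : ∀ ε → ½ * ε + ½ * ε ≡ ε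
  ½+½ ε = trans (sym (*-distribʳ-+ ε ½ ½)) (*-identityˡ ε)

  half-pos : ∀ ε → 0ℚ < ε → 0ℚ < ½ * ε
  half-pos ε 0<ε = positive⁻¹ (½ * ε) {{pos*pos⇒pos ½ ε {{positive 0<ε}}}}

  -- The δ with A * δ ≡ ½ * ε.
  scale : ∀ A → 0ℚ < A → ∀ ε → 0ℚ < ε →
          Σ[ δ ∈ ℚ ] 0ℚ < δ × A * δ ≡ ½ * ε
  scale A 0<A ε 0<ε = 1/ A * (½ * ε) , positive⁻¹ _ {{pos*pos⇒pos (1/ A) {{1/pos⇒pos A}} (½ * ε)}} ,
      trans (sym (*-assoc A (1/ A) (½ * ε)))
     (trans (cong (_* (½ * ε)) (*-inverseʳ A)) (*-identityˡ (½ * ε)))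
    where instance
      A⁺ : Positive A
      A⁺ = positive 0<A
      A≢0 : NonZero A
      A≢0 = pos⇒nonZero A
      ε⁺ : Positive (½ * ε)
      ε⁺ = positive (half-pos ε 0<ε)

  bounded : ∀ {a} → IsCauchy a →
            Σ[ B ∈ ℚ ] 0ℚ < B × Eventually λ n → ∣ a n ∣ ≤ B
  bounded {a} ca with ca 1ℚ (positive⁻¹ 1ℚ)
  ... | N , h = 1ℚ + ∣ a N ∣ , +-mono-<-≤ (positive⁻¹ 1ℚ) (0≤∣p∣ (a N)) , N , λ n N≤n → begin
      ∣ a n ∣                  ≡⟨ cong ∣_∣ (sym (cancel (a n) (a N))) ⟩
      ∣ (a n - a N) + a N ∣    ≤⟨ ∣p+q∣≤∣p∣+∣q∣ (a n - a N) (a N) ⟩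
      ∣ a n - a N ∣ + ∣ a N ∣  ≤⟨ +-monoˡ-≤ ∣ a N ∣ (<⇒≤ (h n N N≤n ℕ.≤-refl)) ⟩
      1ℚ + ∣ a N ∣             ∎
    where open ≤-Reasoning

  prod-bound : ∀ A p q δ → 0ℚ < A → ∣ p ∣ ≤ A → ∣ q ∣ < δ → ∣ p * q ∣ < A * δ
  prod-bound A p q δ 0<A p≤A q<δ = begin-strict
      ∣ p * q ∣      ≡⟨ ∣p*q∣≡∣p∣*∣q∣ p q ⟩
      ∣ p ∣ * ∣ q ∣  ≤⟨ *-monoʳ-≤-nonNeg ∣ q ∣ {{nonNegative (0≤∣p∣ q)}} p≤A ⟩
      A * ∣ q ∣      <⟨ *-monoʳ-<-pos A {{positive 0<A}} q<δ ⟩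
      A * δ          ∎
    where open ≤-Reasoning

  abstract
    +-cauchy : ∀ {a b} → IsCauchy a → IsCauchy b → IsCauchy (λ n → a n + b n)
    +-cauchy {a} {b} ca cb ε 0<ε
      with ca (½ * ε) (half-pos ε 0<ε) | cb (½ * ε) (half-pos ε 0<ε)
    ... | M , h | N , k = M ℕ.⊔ N , λ m n ≤m ≤n → begin-strict
        ∣ (a m + b m) - (a n + b n) ∣
          ≡⟨ cong ∣_∣ (+-differences (a m) (b m) (a n) (b n)) ⟩
        ∣ (a m - a n) + (b m - b n) ∣
          ≤⟨ ∣p+q∣≤∣p∣+∣q∣ (a m - a n) (b m - b n) ⟩
        ∣ a m - a n ∣ + ∣ b m - b n ∣
          <⟨ +-mono-< (h m n (ℕ.m⊔n≤o⇒m≤o M N ≤m) (ℕ.m⊔n≤o⇒m≤o M N ≤n))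
                      (k m n (ℕ.m⊔n≤o⇒n≤o M N ≤m) (ℕ.m⊔n≤o⇒n≤o M N ≤n)) ⟩
        ½ * ε + ½ * ε
          ≡⟨ ½+½ ε ⟩
        ε ∎
      where open ≤-Reasoning

    neg-cauchy : ∀ {a} → IsCauchy a → IsCauchy (λ n → - a n)
    neg-cauchy {a} ca ε 0<ε with ca ε 0<ε
    ... | N , h = N , λ m n ≤m ≤n → subst (_< ε)
          (trans (sym (∣-p∣≡∣p∣ (a m - a n)))
                 (cong ∣_∣ (neg-distrib-+ (a m) (- a n))))
          (h m n ≤m ≤n)

    *-cauchy : ∀ {a b} → IsCauchy a → IsCauchy b → IsCauchy (λ n → a n * b n)
    *-cauchy {a} {b} ca cb ε 0<ε with bounded {a} ca | bounded {b} cb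
    ... | A , 0<A , K , |a|≤A | B , 0<B , L , |b|≤B
      with scale A 0<A ε 0<ε | scale B 0<B ε 0<ε
    ... | δ , 0<δ , Aδ | η , 0<η , Bη with cb δ 0<δ | ca η 0<η
    ... | M , h | N , k = (K ℕ.⊔ L) ℕ.⊔ (M ℕ.⊔ N) , λ m n ≤m ≤n →
      let KL≤m = ℕ.m⊔n≤o⇒m≤o (K ℕ.⊔ L) (M ℕ.⊔ N) ≤m
          KL≤n = ℕ.m⊔n≤o⇒m≤o (K ℕ.⊔ L) (M ℕ.⊔ N) ≤n
          MN≤m = ℕ.m⊔n≤o⇒n≤o (K ℕ.⊔ L) (M ℕ.⊔ N) ≤m
          MN≤n = ℕ.m⊔n≤o⇒n≤o (K ℕ.⊔ L) (M ℕ.⊔ N) ≤n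
      in begin-strict
        ∣ a m * b m - a n * b n ∣
          ≡⟨ cong ∣_∣ (*-differences (a m) (b m) (a n) (b n)) ⟩
        ∣ a m * (b m - b n) + b n * (a m - a n) ∣
          ≤⟨ ∣p+q∣≤∣p∣+∣q∣ (a m * (b m - b n)) (b n * (a m - a n)) ⟩
        ∣ a m * (b m - b n) ∣ + ∣ b n * (a m - a n) ∣
          <⟨ +-mono-<
               (prod-bound A (a m) (b m - b n) δ 0<A (|a|≤A m (ℕ.m⊔n≤o⇒m≤o K L KL≤m))
                 (h m n (ℕ.m⊔n≤o⇒m≤o M N MN≤m) (ℕ.m⊔n≤o⇒m≤o M N MN≤n)))
               (prod-bound B (b n) (a m - a n) η 0<B (|b|≤B n (ℕ.m⊔n≤o⇒n≤o K L KL≤n))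
                 (k m n (ℕ.m⊔n≤o⇒n≤o M N MN≤m) (ℕ.m⊔n≤o⇒n≤o M N MN≤n))) ⟩
        A * δ + B * η
          ≡⟨ cong₂ _+_ Aδ Bη ⟩
        ½ * ε + ½ * ε
          ≡⟨ ½+½ ε ⟩
        ε ∎
      where open ≤-Reasoning

_+ᴿ_ : ℝ → ℝ → ℝ
x +ᴿ y = mkℝ (λ n → seq x n + seq y n) (+-cauchy {seq x} {seq y} (cauchy x) (cauchy y))

-ᴿ_ : ℝ → ℝ
-ᴿ x = mkℝ (λ n → - seq x n) (neg-cauchy {seq x} (cauchy x))

_-ᴿ_ : ℝ → ℝ → ℝ
x -ᴿ y = x +ᴿ (-ᴿ y)

_*ᴿ_ : ℝ → ℝ → ℝ
x *ᴿ y = mkℝ (λ n → seq x n * seq y n) (*-cauchy {seq x} {seq y} (cauchy x) (cauchy y))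

∑ : ∀ {n} → (Fin n → ℝ) → ℝ
∑ = foldr _+ᴿ_ 0ᴿ

Point : ℕ → Set
Point d = Fin d → ℝ

_≈ᴾ_ : ∀ {d} → Point d → Point d → Set
p ≈ᴾ q = ∀ k → p k ≈ᴿ q k

-- An n-element subset of ℝᵈ, given by an enumeration without repetition;
-- its subsets are then the elements of Subset n.
record PointSet (n d : ℕ) : Set where
  field
    point    : Fin n → Point d
    distinct : ∀ {i j} → point i ≈ᴾ point j → i ≡ j
open PointSet public

-- p ∈conv[ X , S ] : p is a convex combination of the points of X with index in S.
-- In particular the hull of the empty set is empty.
record _∈conv[_,_] {n d} (p : Point d) (X : PointSet n d) (S : Subset n) : Set where
  field
    weight      : Fin n → ℝ
    weight≥0    : ∀ i → 0ᴿ ≤ᴿ weight i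
    supported   : ∀ i → i ∉ S → weight i ≈ᴿ 0ᴿ
    total       : ∑ weight ≈ᴿ 1ᴿ
    combination : p ≈ᴾ λ k → ∑ λ i → weight i *ᴿ point X i k

-- Blocks may be empty here, but in Tolerates an empty block
-- is excluded by the case Y = ∅.
record IsPartition {n r} (A : Fin r → Subset n) : Set where
  field
    covers   : ∀ x → ∃[ i ] x ∈ A i
    disjoint : ∀ {x i j} → x ∈ A i → x ∈ A j → i ≡ j

Tolerates : ∀ {n d} → PointSet n d → (r t : ℕ) → Set
Tolerates {n} {d} X r t =
  Σ[ A ∈ (Fin r → Subset n) ] IsPartition A ×
    (∀ (Y : Subset n) → card Y ℕ.≤ t →
      Σ[ p ∈ Point d ] (∀ i → p ∈conv[ X , A i ─ Y ]))

-- t(X,r) = t.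
IsTolerance : ∀ {n d} → PointSet n d → (r t : ℕ) → Set
IsTolerance X r t = Tolerates X r t × (∀ s → Tolerates X r s → s ℕ.≤ t)

-- t(n,d,r) = t, including that t(X,r) is defined for every n-point set X.
IsMinTolerance : (n d r t : ℕ) → Set
IsMinTolerance n d r t =
  (∀ (X : PointSet n d) → ∃[ s ] IsTolerance X r s × t ℕ.≤ s) ×
  (Σ[ X ∈ PointSet n d ] IsTolerance X r t)

{-# OPTIONS --safe #-}
module Submission where

-- Let x̂ = (1 , x) ∈ ℝᵈ⁺¹. For a partition A₁, …, Aᵣ of X and a deleted set Y, Sarkaria's tensor trick and
-- Gordan's theorem give: either the sets conv (A_c ∖ Y) have a common point, or there are affine
-- functions f₁, …, fᵣ with Σ f_c = 0 such that f_c < 0 on A_c ∖ Y. In the second case the sets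
-- S_c = {x ∈ X : f_c(x) ≥ 0} cover X, while only points of Y can lie in A_c ∩ S_c for their own
-- class c, so n ≤ Σ |S_c| and Σ |A_c ∩ S_c| ≤ |Y|. If every half-space meets every class in at least
-- 1/r of its points up to an error o(n), this forces |Y| ≥ n/r − o(n).
-- Such a balanced partition exists because half-spaces cut only (n+1)^(d+1) subsets out of X:
-- points are coloured one by one, never increasing an exponential potential summed over all
-- half-space sections and all colours, and an exponential beats a polynomial.

-- The partition has to be fixed before `Y` is known, while the separating functions depend on `Y`.
-- Hence balance is asked of every half-space section at once, and it is the polynomial number of
-- sections that makes this affordable. The error is measured by a fixed integer `L`: a class may
-- fall short of its share of a section by `n / (L r)` points, so that summing over the classes
-- gives |Y| ≥ n/r - n/L whenever the hulls have no common point. The colouring is a derandomised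
-- Chernoff bound; integer factors stand in for the exponential moments, so the whole comparison
-- stays in the natural numbers. On the geometric side every elimination is a cross-multiplication:
-- the linear algebra then needs an ordered ring only, and a single inverse remains, the one that
-- normalises the convex weights.

open import Algebra.Bundles using (CommutativeRing)
open import Axiom.ExcludedMiddle using (ExcludedMiddle)
open import Data.Bool using (Bool; true; false; if_then_else_; _∧_; not)
open import Data.Bool.Properties using (∧-identityʳ; ∧-zeroʳ)
open import Data.Empty using (⊥-elim)
open import Data.Fin as Fin using (Fin; zero; suc; toℕ; punchIn; punchOut; combine; remQuot; _↑ˡ_; _↑ʳ_)
open import Data.Fin.Properties using (toℕ-injective; punchIn-punchOut; remQuot-combine)
open import Data.Fin.Subset using (Subset; inside; outside; ⊤; ∁) renaming (∣_∣ to card)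
open import Data.Integer as ℤ using (ℤ; -[1+_]; _⊖_; _◃_)
import Data.Integer.Properties as ℤ
open import Data.List as List using (List; []; _∷_; _++_)
open import Data.List.Properties using (length-++; length-map)
open import Data.Maybe using (Maybe; just; nothing)
open import Data.Nat as ℕ using (ℕ; zero; suc; z≤n; s≤s)
import Data.Nat.DivMod as ℕ
import Data.Nat.Properties as ℕ
open import Data.Nat.Tactic.RingSolver using (solve-∀)
open import Data.Product using (Σ-syntax; ∃-syntax; _×_; _,_; proj₁; proj₂)
import Data.Sign as Sign
open import Data.Sum using (_⊎_; inj₁; inj₂)
open import Data.Vec as Vec using (Vec; []; _∷_; lookup; tabulate)
open import Data.Vec.Functional using (Vector; insertAt; removeAt)
open import Data.Vec.Functional.Properties using (insertAt-lookup; insertAt-punchIn)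
open import Data.Vec.Properties using (lookup∘tabulate; []=⇒lookup; lookup⇒[]=; lookup-map)
open import Function using (_∘_)
open import Level using (0ℓ)
open import Relation.Nullary using (¬_; Dec; yes; no; does)
open import Relation.Nullary.Decidable using (dec-true)
import Relation.Binary.PropositionalEquality as ≡
open ≡ using (_≡_; _≢_; module ≡-Reasoning)

open import Defs

-- Linear algebra over ordered rings

-- Equality in the ring need not be decidable, as for the reals, so polynomials are normalised with
-- integer coefficients, read as multiples of `1#`; `≟-weak` compares only these integers.
module IntegerSolver (R : CommutativeRing 0ℓ 0ℓ) where
  open CommutativeRing R
  open import Algebra.Properties.Ring ring using (-‿distribˡ-*; -‿distribʳ-*; -‿+-comm; -0#≈0#; -‿involutive)
  open import Algebra.Properties.Semiring.Mult semiring using (×1-homo-*; ×-homo-+) renaming (_×_ to _×′_)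
  open import Algebra.Solver.Ring.AlmostCommutativeRing using (fromCommutativeRing; _-Raw-AlmostCommutative⟶_)
  open import Relation.Binary.Reasoning.Setoid setoid

  ⟦_⟧ℤ : ℤ → Carrier
  ⟦ ℤ.+ n ⟧ℤ = n ×′ 1#
  ⟦ -[1+ n ] ⟧ℤ = - (suc n ×′ 1#)

  private
    N : ℕ → Carrier
    N n = n ×′ 1#

    ⟦-⟧ : ∀ i → ⟦ ℤ.- i ⟧ℤ ≈ - ⟦ i ⟧ℤ
    ⟦-⟧ (ℤ.+ zero) = sym -0#≈0#
    ⟦-⟧ (ℤ.+ suc n) = refl
    ⟦-⟧ -[1+ n ] = sym (-‿involutive _)

    cancel-1 : ∀ x y → x - y ≈ (1# + x) - (1# + y)
    cancel-1 x y = begin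
      x - y                    ≈⟨ +-congʳ (+-identityˡ x) ⟨
      (0# + x) - y             ≈⟨ +-congʳ (+-congʳ (-‿inverseˡ 1#)) ⟨
      (- 1# + 1# + x) - y      ≈⟨ +-congʳ (+-assoc _ _ _) ⟩
      (- 1# + (1# + x)) - y    ≈⟨ +-congʳ (+-comm _ _) ⟩
      ((1# + x) - 1#) - y      ≈⟨ +-assoc _ _ _ ⟩
      (1# + x) + (- 1# - y)    ≈⟨ +-congˡ (-‿+-comm 1# y) ⟩
      (1# + x) - (1# + y)      ∎

    ⟦⊖⟧ : ∀ m n → ⟦ m ⊖ n ⟧ℤ ≈ N m - N n
    ⟦⊖⟧ m zero = sym (trans (+-congˡ -0#≈0#) (+-identityʳ _))
    ⟦⊖⟧ zero (suc n) = sym (+-identityˡ _)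
    ⟦⊖⟧ (suc m) (suc n) = begin
      ⟦ suc m ⊖ suc n ⟧ℤ  ≡⟨ ≡.cong ⟦_⟧ℤ (ℤ.[1+m]⊖[1+n]≡m⊖n m n) ⟩
      ⟦ m ⊖ n ⟧ℤ          ≈⟨ ⟦⊖⟧ m n ⟩
      N m - N n           ≈⟨ cancel-1 (N m) (N n) ⟩
      N (suc m) - N (suc n) ∎

    ⟦+⟧ : ∀ i j → ⟦ i ℤ.+ j ⟧ℤ ≈ ⟦ i ⟧ℤ + ⟦ j ⟧ℤ
    ⟦+⟧ (ℤ.+ m) (ℤ.+ n) = ×-homo-+ 1# m n
    ⟦+⟧ (ℤ.+ m) -[1+ n ] = ⟦⊖⟧ m (suc n)
    ⟦+⟧ -[1+ m ] (ℤ.+ n) = trans (⟦⊖⟧ n (suc m)) (+-comm _ _)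
    ⟦+⟧ -[1+ m ] -[1+ n ] = begin
      - N (suc (suc (m ℕ.+ n)))    ≡⟨ ≡.cong (λ k → - N k) (ℕ.+-suc (suc m) n) ⟨
      - N (suc m ℕ.+ suc n)        ≈⟨ -‿cong (×-homo-+ 1# (suc m) (suc n)) ⟩
      - (N (suc m) + N (suc n))    ≈⟨ -‿+-comm _ _ ⟨
      - N (suc m) - N (suc n)      ∎

    ⟦-◃⟧ : ∀ n → ⟦ Sign.- ◃ n ⟧ℤ ≈ - N n
    ⟦-◃⟧ zero = sym -0#≈0#
    ⟦-◃⟧ (suc n) = refl

    ⟦+◃⟧ : ∀ n → ⟦ Sign.+ ◃ n ⟧ℤ ≈ N n
    ⟦+◃⟧ zero = refl
    ⟦+◃⟧ (suc n) = refl

    ⟦*⟧ : ∀ i j → ⟦ i ℤ.* j ⟧ℤ ≈ ⟦ i ⟧ℤ * ⟦ j ⟧ℤ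
    ⟦*⟧ (ℤ.+ m) (ℤ.+ n) = trans (⟦+◃⟧ (m ℕ.* n)) (×1-homo-* m n)
    ⟦*⟧ (ℤ.+ m) -[1+ n ] = trans (⟦-◃⟧ (m ℕ.* suc n))
      (trans (-‿cong (×1-homo-* m (suc n))) (-‿distribʳ-* _ _))
    ⟦*⟧ -[1+ m ] (ℤ.+ n) = trans (⟦-◃⟧ (suc m ℕ.* n))
      (trans (-‿cong (×1-homo-* (suc m) n)) (-‿distribˡ-* _ _))
    ⟦*⟧ -[1+ m ] -[1+ n ] = begin
      N (suc m ℕ.* suc n)            ≈⟨ ×1-homo-* (suc m) (suc n) ⟩
      N (suc m) * N (suc n)          ≈⟨ -‿involutive _ ⟨
      - - (N (suc m) * N (suc n))    ≈⟨ -‿cong (-‿distribʳ-* _ _) ⟩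
      - (N (suc m) * - N (suc n))    ≈⟨ -‿distribˡ-* _ _ ⟩
      - N (suc m) * - N (suc n)      ∎

    morphism : ℤ.+-*-rawRing -Raw-AlmostCommutative⟶ fromCommutativeRing R
    morphism = record
      { ⟦_⟧ = ⟦_⟧ℤ ; +-homo = ⟦+⟧ ; *-homo = ⟦*⟧ ; -‿homo = ⟦-⟧
      ; 0-homo = refl ; 1-homo = +-identityʳ 1# }

    ≟-weak : ∀ i j → Maybe (⟦ i ⟧ℤ ≈ ⟦ j ⟧ℤ)
    ≟-weak i j with i ℤ.≟ j
    ... | yes i≡j = just (reflexive (≡.cong ⟦_⟧ℤ i≡j))
    ... | no _ = nothing

  open import Algebra.Solver.Ring ℤ.+-*-rawRing (fromCommutativeRing R) morphism ≟-weak public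
    using (solve; _:+_; _:*_; _:-_; :-_; _:=_; con)

-- Induction step for the count of sign patterns: the first term counts patterns of the points that
-- remain after deleting one, the second those that the deleted point splits, which live in one
-- dimension less.
power-step : ∀ n D → suc n ℕ.^ suc D ℕ.+ suc n ℕ.^ D ℕ.≤ suc (suc n) ℕ.^ suc D
power-step n D = begin
  suc n ℕ.* suc n ℕ.^ D ℕ.+ suc n ℕ.^ D  ≡⟨ ℕ.+-comm (suc n ℕ.* suc n ℕ.^ D) _ ⟩
  suc (suc n) ℕ.* suc n ℕ.^ D            ≤⟨ ℕ.*-monoʳ-≤ (suc (suc n)) (ℕ.^-monoˡ-≤ D (ℕ.n≤1+n (suc n))) ⟩
  suc (suc n) ℕ.^ suc D                  ∎
  where open ℕ.≤-Reasoning

-- An order presented by its positive elements. For the reals `trichotomy` is the one field that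
-- rests on excluded middle.
record PositiveCone (R : CommutativeRing 0ℓ 0ℓ) : Set₁ where
  open CommutativeRing R
  field
    Pos        : Carrier → Set
    pos-resp   : ∀ {x y} → x ≈ y → Pos x → Pos y
    pos+pos    : ∀ {x y} → Pos x → Pos y → Pos (x + y)
    pos*pos    : ∀ {x y} → Pos x → Pos y → Pos (x * y)
    pos-1      : Pos 1#
    0-not-pos  : ¬ Pos 0#
    trichotomy : ∀ x → Pos x ⊎ x ≈ 0# ⊎ Pos (- x)

module OrderedRing (R : CommutativeRing 0ℓ 0ℓ) (P : PositiveCone R) where
  open CommutativeRing R hiding (zero)
  open PositiveCone P public
  open import Data.List.Membership.Propositional using (_∈_)
  open import Data.List.Membership.Propositional.Properties using (∈-++⁺ˡ; ∈-++⁺ʳ; ∈-map⁺)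
  open import Data.List.Relation.Unary.Any using (here)
  open IntegerSolver R
  open import Algebra.Properties.Ring ring using (-0#≈0#)
  open import Algebra.Properties.Semiring.Sum semiring public
  open import Relation.Binary.Reasoning.Setoid setoid

  NonNeg Neg : Carrier → Set
  NonNeg x = Pos x ⊎ x ≈ 0#
  Neg x = Pos (- x)

  nonNeg-resp : ∀ {x y} → x ≈ y → NonNeg x → NonNeg y
  nonNeg-resp x≈y (inj₁ p) = inj₁ (pos-resp x≈y p)
  nonNeg-resp x≈y (inj₂ z) = inj₂ (trans (sym x≈y) z)

  neg-resp : ∀ {x y} → x ≈ y → Neg x → Neg y
  neg-resp x≈y = pos-resp (-‿cong x≈y)

  nonNeg⊎neg : ∀ x → NonNeg x ⊎ Neg x
  nonNeg⊎neg x with trichotomy x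
  ... | inj₁ p = inj₁ (inj₁ p)
  ... | inj₂ (inj₁ z) = inj₁ (inj₂ z)
  ... | inj₂ (inj₂ n) = inj₂ n

  pos+nonNeg : ∀ {x y} → Pos x → NonNeg y → Pos (x + y)
  pos+nonNeg p (inj₁ q) = pos+pos p q
  pos+nonNeg p (inj₂ z) = pos-resp (sym (trans (+-congˡ z) (+-identityʳ _))) p

  nonNeg+pos : ∀ {x y} → NonNeg x → Pos y → Pos (x + y)
  nonNeg+pos n p = pos-resp (+-comm _ _) (pos+nonNeg p n)

  nonNeg+nonNeg : ∀ {x y} → NonNeg x → NonNeg y → NonNeg (x + y)
  nonNeg+nonNeg (inj₁ p) n = inj₁ (pos+nonNeg p n)
  nonNeg+nonNeg (inj₂ z) n = nonNeg-resp (sym (trans (+-congʳ z) (+-identityˡ _))) n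

  nonNeg*nonNeg : ∀ {x y} → NonNeg x → NonNeg y → NonNeg (x * y)
  nonNeg*nonNeg (inj₁ p) (inj₁ q) = inj₁ (pos*pos p q)
  nonNeg*nonNeg (inj₂ z) _        = inj₂ (trans (*-congʳ z) (zeroˡ _))
  nonNeg*nonNeg (inj₁ _) (inj₂ z) = inj₂ (trans (*-congˡ z) (zeroʳ _))

  pos*neg : ∀ {x y} → Pos x → Neg y → Neg (x * y)
  pos*neg {x} {y} p q = pos-resp (solve 2 (λ x y → x :* :- y := :- (x :* y)) refl x y) (pos*pos p q)

  neg⇒¬nonNeg : ∀ {x} → Neg x → ¬ NonNeg x
  neg⇒¬nonNeg {x} n p = 0-not-pos (pos-resp (-‿inverseˡ x) (pos+nonNeg n p))

  pos*neg+nonNeg*neg : ∀ {a b x y} → Pos a → NonNeg b → Neg x → Neg y → Neg (a * x + b * y)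
  pos*neg+nonNeg*neg {a} {b} {x} {y} p q m n = pos-resp
    (solve 4 (λ a b x y → a :* (:- x) :+ b :* (:- y) := :- (a :* x :+ b :* y)) refl a b x y)
    (pos+nonNeg (pos*pos p m) (nonNeg*nonNeg q (inj₁ n)))

  square-pos : ∀ {x} → ¬ (x ≈ 0#) → Pos (x * x)
  square-pos {x} x≉0 with trichotomy x
  ... | inj₁ p = pos*pos p p
  ... | inj₂ (inj₁ z) = ⊥-elim (x≉0 z)
  ... | inj₂ (inj₂ n) = pos-resp (solve 1 (λ x → :- x :* :- x := x :* x) refl x) (pos*pos n n)

  square-nonNeg : ∀ x → NonNeg (x * x)
  square-nonNeg x with trichotomy x
  ... | inj₁ p = inj₁ (pos*pos p p)
  ... | inj₂ (inj₁ z) = inj₂ (trans (*-congʳ z) (zeroˡ _))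
  ... | inj₂ (inj₂ n) = inj₁ (pos-resp (solve 1 (λ x → :- x :* :- x := x :* x) refl x) (pos*pos n n))

  pos-cancelˡ : ∀ {s x} → Pos s → Pos (s * x) → Pos x
  pos-cancelˡ {s} {x} s>0 sx>0 with trichotomy x
  ... | inj₁ p = p
  ... | inj₂ (inj₁ z) = ⊥-elim (0-not-pos (pos-resp (trans (*-congˡ z) (zeroʳ _)) sx>0))
  ... | inj₂ (inj₂ n) = ⊥-elim (0-not-pos (pos-resp
          (solve 2 (λ s x → s :* x :+ s :* :- x := con (ℤ.+ 0)) refl s x)
          (pos+pos sx>0 (pos*pos s>0 n))))

  sum-zero : ∀ {n} {f : Vector Carrier n} → (∀ i → f i ≈ 0#) → sum f ≈ 0#
  sum-zero {n} f≈0 = trans (sum-cong-≋ f≈0) (sum-replicate-zero n)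

  sum-neg : ∀ {n} (f : Vector Carrier n) → sum (λ i → - f i) ≈ - sum f
  sum-neg f = begin
    sum (λ i → - f i)        ≈⟨ sum-cong-≋ (λ i → solve 1 (λ x → :- x := con (ℤ.- (ℤ.+ 1)) :* x) refl (f i)) ⟩
    sum (λ i → m * f i)      ≈⟨ *-distribˡ-sum m f ⟨
    m * sum f                ≈⟨ solve 1 (λ x → con (ℤ.- (ℤ.+ 1)) :* x := :- x) refl (sum f) ⟩
    - sum f                  ∎
    where
      m = ⟦ ℤ.- (ℤ.+ 1) ⟧ℤ

  sum-nonNeg : ∀ {n} {f : Vector Carrier n} → (∀ i → NonNeg (f i)) → NonNeg (sum f)
  sum-nonNeg {zero} h = inj₂ refl
  sum-nonNeg {suc n} h = nonNeg+nonNeg (h zero) (sum-nonNeg (λ i → h (suc i)))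

  sum-pos : ∀ {n} {f : Vector Carrier n} → (∀ i → NonNeg (f i)) → ∀ i → Pos (f i) → Pos (sum f)
  sum-pos {suc n} h zero p = pos+nonNeg p (sum-nonNeg (λ i → h (suc i)))
  sum-pos {suc n} h (suc i) p = nonNeg+pos (h zero) (sum-pos (λ i → h (suc i)) i p)

  sum-pos⇒term-pos : ∀ {n} {f : Vector Carrier n} → (∀ i → NonNeg (f i)) → Pos (sum f) → ∃[ i ] Pos (f i)
  sum-pos⇒term-pos {zero} h p = ⊥-elim (0-not-pos p)
  sum-pos⇒term-pos {suc n} h p with h zero
  ... | inj₁ q = zero , q
  ... | inj₂ z with sum-pos⇒term-pos (λ i → h (suc i)) (pos-resp (trans (+-congʳ z) (+-identityˡ _)) p)
  ...   | i , q = suc i , q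

  zero⊎pivot : ∀ {D} (v : Vector Carrier D) → (∀ l → v l ≈ 0#) ⊎ (∃[ k ] ¬ (v k ≈ 0#))
  zero⊎pivot {zero} v = inj₁ λ ()
  zero⊎pivot {suc D} v with trichotomy (v zero)
  ... | inj₁ p = inj₂ (zero , λ z → 0-not-pos (pos-resp z p))
  ... | inj₂ (inj₂ n) = inj₂ (zero , λ z → 0-not-pos (pos-resp (trans (-‿cong z) -0#≈0#) n))
  ... | inj₂ (inj₁ z) with zero⊎pivot (λ l → v (suc l))
  ...   | inj₁ h = inj₁ λ { zero → z ; (suc l) → h l }
  ...   | inj₂ (k , h) = inj₂ (suc k , h)

  -- Pairing of vectors and projection along one of them

  infix 7 _·_

  _·_ : ∀ {D} → Vector Carrier D → Vector Carrier D → Carrier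
  u · v = sum (λ l → u l * v l)

  ·-zeroʳ : ∀ {D} (u : Vector Carrier D) {v} → (∀ l → v l ≈ 0#) → u · v ≈ 0#
  ·-zeroʳ u h = sum-zero (λ l → trans (*-congˡ (h l)) (zeroʳ _))

  ·-linearˡ : ∀ {D} a b (u v y : Vector Carrier D) →
              (λ l → a * u l + b * v l) · y ≈ a * (u · y) + b * (v · y)
  ·-linearˡ a b u v y = begin
    sum (λ l → (a * u l + b * v l) * y l)
      ≈⟨ sum-cong-≋ (λ l → solve 5 (λ a b u v y → (a :* u :+ b :* v) :* y := a :* (u :* y) :+ b :* (v :* y))
                             refl a b (u l) (v l) (y l)) ⟩
    sum (λ l → a * (u l * y l) + b * (v l * y l))
      ≈⟨ ∑-distrib-+ (λ l → a * (u l * y l)) (λ l → b * (v l * y l)) ⟩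
    sum (λ l → a * (u l * y l)) + sum (λ l → b * (v l * y l))
      ≈⟨ +-cong (*-distribˡ-sum a (λ l → u l * y l)) (*-distribˡ-sum b (λ l → v l * y l)) ⟨
    a * (u · y) + b * (v · y) ∎

  ·-sum : ∀ {n D} (u : Vector Carrier D) (w : Vector Carrier n) (z : Fin n → Vector Carrier D) →
          u · (λ l → sum (λ i → w i * z i l)) ≈ sum (λ i → w i * (u · z i))
  ·-sum u w z = begin
    sum (λ l → u l * sum (λ i → w i * z i l))
      ≈⟨ sum-cong-≋ (λ l → *-distribˡ-sum (u l) (λ i → w i * z i l)) ⟩
    sum (λ l → sum (λ i → u l * (w i * z i l)))
      ≈⟨ ∑-comm (λ l i → u l * (w i * z i l)) ⟩
    sum (λ i → sum (λ l → u l * (w i * z i l)))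
      ≈⟨ sum-cong-≋ (λ i → sum-cong-≋ (λ l →
           solve 3 (λ u w z → u :* (w :* z) := w :* (u :* z)) refl (u l) (w i) (z i l))) ⟩
    sum (λ i → sum (λ l → w i * (u l * z i l)))
      ≈⟨ sum-cong-≋ (λ i → *-distribˡ-sum (w i) (λ l → u l * z i l)) ⟨
    sum (λ i → w i * (u · z i)) ∎

  self-·-pos : ∀ {D} (v : Vector Carrier D) k → ¬ (v k ≈ 0#) → Pos (v · v)
  self-·-pos v k h = sum-pos (λ l → square-nonNeg (v l)) k (square-pos h)

  -- Division-free projection along v onto the coordinates other than the pivot k:
  -- up to the positive factor v k * v k it subtracts the multiple of v that kills coordinate k.
  module Projection {D} (v : Vector Carrier (suc D)) (k : Fin (suc D)) where

    s : Carrier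
    s = v k * v k

    project : Vector Carrier (suc D) → Vector Carrier D
    project y l = s * y (punchIn k l) - v k * y k * v (punchIn k l)

    private
      ·-remove : ∀ (u y : Vector Carrier (suc D)) →
                 u · y ≈ u k * y k + removeAt u k · removeAt y k
      ·-remove u y = sum-remove {i = k} (λ l → u l * y l)

      ·-project : ∀ (g : Vector Carrier D) y →
        g · project y ≈ s * (g · removeAt y k) - v k * y k * (g · removeAt v k)
      ·-project g y = begin
        sum (λ l → g l * (s * y (punchIn k l) - v k * y k * v (punchIn k l)))
          ≈⟨ sum-cong-≋ (λ l → solve 5 (λ g s y t v → g :* (s :* y :- t :* v) := s :* (g :* y) :+ (:- t) :* (g :* v))
                                 refl (g l) s (y (punchIn k l)) (v k * y k) (v (punchIn k l))) ⟩
        sum (λ l → s * (g l * y (punchIn k l)) + (- (v k * y k)) * (g l * v (punchIn k l)))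
          ≈⟨ ∑-distrib-+ (λ l → s * (g l * y (punchIn k l))) (λ l → (- (v k * y k)) * (g l * v (punchIn k l))) ⟩
        sum (λ l → s * (g l * y (punchIn k l))) + sum (λ l → (- (v k * y k)) * (g l * v (punchIn k l)))
          ≈⟨ +-cong (*-distribˡ-sum s (λ l → g l * y (punchIn k l)))
                    (*-distribˡ-sum (- (v k * y k)) (λ l → g l * v (punchIn k l))) ⟨
        s * (g · removeAt y k) + (- (v k * y k)) * (g · removeAt v k)
          ≈⟨ solve 4 (λ s p t q → s :* p :+ (:- t) :* q := s :* p :- t :* q)
               refl s (g · removeAt y k) (v k * y k) (g · removeAt v k) ⟩
        s * (g · removeAt y k) - v k * y k * (g · removeAt v k) ∎

    -- The transpose of `project`; the entry at the pivot is forced by the adjunction `lift-·`.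
    lift : Vector Carrier D → Vector Carrier (suc D)
    lift g = insertAt (λ l → s * g l) k (- (v k * (g · removeAt v k)))

    lift-· : ∀ g y → lift g · y ≈ g · project y
    lift-· g y = begin
      lift g · y
        ≈⟨ ·-remove (lift g) y ⟩
      lift g k * y k + removeAt (lift g) k · removeAt y k
        ≈⟨ +-cong (*-congʳ (reflexive (insertAt-lookup (λ l → s * g l) k _)))
                  (sum-cong-≋ (λ l → trans (*-congʳ (reflexive (insertAt-punchIn (λ l → s * g l) k _ l)))
                                           (*-assoc s (g l) (y (punchIn k l))))) ⟩
      - (v k * (g · removeAt v k)) * y k + sum (λ l → s * (g l * y (punchIn k l)))
        ≈⟨ +-congˡ (*-distribˡ-sum s (λ l → g l * y (punchIn k l))) ⟨
      - (v k * (g · removeAt v k)) * y k + s * (g · removeAt y k)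
        ≈⟨ solve 5 (λ s p t q a → :- (t :* q) :* a :+ s :* p := s :* p :- t :* a :* q)
             refl s (g · removeAt y k) (v k) (g · removeAt v k) (y k) ⟩
      s * (g · removeAt y k) - v k * y k * (g · removeAt v k)
        ≈⟨ ·-project g y ⟨
      g · project y ∎

    project-self : ∀ l → project v l ≈ 0#
    project-self l = -‿inverseʳ (s * v (punchIn k l))

    lift-·-self : ∀ g → lift g · v ≈ 0#
    lift-·-self g = trans (lift-· g v) (·-zeroʳ g project-self)

    -- A functional that kills `v` factors through the projection. The pivot contributes the same
    -- amount to `s * (h · y)` and to `v k * y k * (h · v)`, so it can be restored in both at no
    -- cost.
    restrict-· : ∀ h y → h · v ≈ 0# → removeAt h k · project y ≈ s * (h · y)
    restrict-· h y h·v≈0 = begin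
      removeAt h k · project y
        ≈⟨ ·-project (removeAt h k) y ⟩
      s * (removeAt h k · removeAt y k) - v k * y k * (removeAt h k · removeAt v k)
        ≈⟨ solve 5 (λ c p a q h → c :* c :* p :- c :* a :* q :=
                                   c :* c :* (h :* a :+ p) :- c :* a :* (h :* c :+ q))
             refl (v k) (removeAt h k · removeAt y k) (y k) (removeAt h k · removeAt v k) (h k) ⟩
      s * (h k * y k + removeAt h k · removeAt y k) - v k * y k * (h k * v k + removeAt h k · removeAt v k)
        ≈⟨ +-cong (*-congˡ (·-remove h y)) (-‿cong (*-congˡ (·-remove h v))) ⟨
      s * (h · y) - v k * y k * (h · v)
        ≈⟨ +-congˡ (-‿cong (trans (*-congˡ h·v≈0) (zeroʳ _))) ⟩
      s * (h · y) - 0#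
        ≈⟨ trans (+-congˡ -0#≈0#) (+-identityʳ _) ⟩
      s * (h · y) ∎

    project-sum : ∀ {n} (w : Vector Carrier n) (z : Fin n → Vector Carrier (suc D)) l →
      sum (λ i → w i * project (z i) l) ≈ project (λ l → sum (λ i → w i * z i l)) l
    project-sum w z l = begin
      sum (λ i → w i * (s * z i l′ - v k * z i k * v l′))
        ≈⟨ sum-cong-≋ (λ i → solve 6 (λ w s y t a v → w :* (s :* y :- t :* a :* v) :=
                                        s :* (w :* y) :+ (:- t :* v) :* (w :* a))
                               refl (w i) s (z i l′) (v k) (z i k) (v l′)) ⟩
      sum (λ i → s * (w i * z i l′) + (- v k * v l′) * (w i * z i k))
        ≈⟨ ∑-distrib-+ (λ i → s * (w i * z i l′)) (λ i → (- v k * v l′) * (w i * z i k)) ⟩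
      sum (λ i → s * (w i * z i l′)) + sum (λ i → (- v k * v l′) * (w i * z i k))
        ≈⟨ +-cong (*-distribˡ-sum s (λ i → w i * z i l′)) (*-distribˡ-sum (- v k * v l′) (λ i → w i * z i k)) ⟨
      s * sum (λ i → w i * z i l′) + (- v k * v l′) * sum (λ i → w i * z i k)
        ≈⟨ solve 5 (λ s p t v q → s :* p :+ (:- t :* v) :* q := s :* p :- t :* q :* v)
             refl s (sum (λ i → w i * z i l′)) (v k) (v l′) (sum (λ i → w i * z i k)) ⟩
      s * sum (λ i → w i * z i l′) - v k * sum (λ i → w i * z i k) * v l′ ∎
      where l′ = punchIn k l

    -- The kernel of the projection is the line of `v`. At the pivot both sides agree identically;
    -- elsewhere their difference is a coordinate of `project y`.
    project-kernel : ∀ y → (∀ l → project y l ≈ 0#) → ∀ l → s * y l ≈ v k * y k * v l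
    project-kernel y h l with k Fin.≟ l
    ... | yes ≡.refl = solve 2 (λ a b → a :* a :* b := a :* b :* a) refl (v k) (y k)
    ... | no k≢l = begin
      s * y l                        ≈⟨ solve 2 (λ a b → a := (a :- b) :+ b) refl (s * y l) (v k * y k * v l) ⟩
      (s * y l - v k * y k * v l) + v k * y k * v l
        ≡⟨ ≡.cong (λ m → (s * y m - v k * y k * v m) + v k * y k * v l) (punchIn-punchOut k≢l) ⟨
      project y (punchOut k≢l) + v k * y k * v l
                                     ≈⟨ +-congʳ (h (punchOut k≢l)) ⟩
      0# + v k * y k * v l           ≈⟨ +-identityˡ _ ⟩
      v k * y k * v l                ∎

  -- Rescaling K and M together keeps every earlier inequality, so no division is needed.
  dominate : ∀ {n} (B : Subset n) (a b : Vector Carrier n) →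
    (∀ i → lookup B i ≡ inside → Pos (a i)) →
    Σ[ K ∈ Carrier ] Σ[ M ∈ Carrier ] Pos K × Pos M ×
      (∀ i → lookup B i ≡ inside → Pos (K * a i + M * b i))
  dominate [] a b h = 1# , 1# , pos-1 , pos-1 , λ ()
  dominate (β ∷ B) a b h with dominate B (λ i → a (suc i)) (λ i → b (suc i)) (λ i → h (suc i))
  dominate (outside ∷ B) a b h | K , M , K>0 , M>0 , rest =
    K , M , K>0 , M>0 , λ { (suc i) → rest i }
  dominate (inside ∷ B) a b h | K , M , K>0 , M>0 , rest with nonNeg⊎neg (b zero)
  ... | inj₁ b≥0 = K , M , K>0 , M>0 , λ
    { zero _ → pos+nonNeg (pos*pos K>0 (h zero ≡.refl)) (nonNeg*nonNeg (inj₁ M>0) b≥0)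
    ; (suc i) → rest i }
  ... | inj₂ b<0 = K * a zero + M * (- b zero) , M * a zero ,
      pos+pos (pos*pos K>0 a>0) (pos*pos M>0 b<0) , pos*pos M>0 a>0 , λ
      { zero _ → pos-resp
          (solve 4 (λ K M a b → K :* (a :* a) := (K :* a :+ M :* (:- b)) :* a :+ M :* a :* b)
             refl K M (a zero) (b zero))
          (pos*pos K>0 (pos*pos a>0 a>0))
      ; (suc i) i∈B → pos-resp
          (solve 6 (λ K M a b x y → a :* (K :* x :+ M :* y) :+ M :* (:- b) :* x :=
                                    (K :* a :+ M :* (:- b)) :* x :+ M :* a :* y)
             refl K M (a zero) (b zero) (a (suc i)) (b (suc i)))
          (pos+pos (pos*pos a>0 (rest i i∈B)) (pos*pos (pos*pos M>0 b<0) (h (suc i) i∈B))) }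
    where a>0 = h zero ≡.refl

  -- Gordan's theorem of the alternative

  Separated : ∀ {n D} → (Fin n → Vector Carrier D) → Subset n → Set
  Separated {D = D} z B = Σ[ u ∈ Vector Carrier D ] (∀ i → lookup B i ≡ inside → Neg (u · z i))

  record Dependent {n D} (z : Fin n → Vector Carrier D) (B : Subset n) : Set where
    field
      weight    : Vector Carrier n
      nonNeg    : ∀ i → NonNeg (weight i)
      supported : ∀ i → lookup B i ≡ outside → weight i ≈ 0#
      total     : Pos (sum weight)
      null      : ∀ l → sum (λ i → weight i * z i l) ≈ 0#

  weighted-neg : ∀ {n} (B : Subset n) {w f : Vector Carrier n} → (∀ i → NonNeg (w i)) →
    (∀ i → lookup B i ≡ outside → w i ≈ 0#) → Pos (sum w) →
    (∀ i → lookup B i ≡ inside → Neg (f i)) → Neg (sum (λ i → w i * f i))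
  weighted-neg B {w} {f} w≥0 w-off w-total f<0 =
    pos-resp (sum-neg (λ i → w i * f i)) (sum-pos terms i₀ (pos-term i₀ wi₀>0))
    where
      pos-term : ∀ i → Pos (w i) → Neg (w i * f i)
      pos-term i wi>0 with lookup B i in eq
      ... | inside = pos*neg wi>0 (f<0 i eq)
      ... | outside = ⊥-elim (0-not-pos (pos-resp (w-off i eq) wi>0))
      terms : ∀ i → NonNeg (- (w i * f i))
      terms i with w≥0 i
      ... | inj₁ wi>0 = inj₁ (pos-term i wi>0)
      ... | inj₂ wi≈0 = inj₂ (trans (-‿cong (trans (*-congʳ wi≈0) (zeroˡ _))) -0#≈0#)
      witness = sum-pos⇒term-pos w≥0 w-total
      i₀ = proj₁ witness
      wi₀>0 = proj₂ witness

  prepend-zero : ∀ {n D β} (z : Fin (suc n) → Vector Carrier D) {B : Subset n} →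
    Dependent (λ i → z (suc i)) B → Dependent z (β ∷ B)
  prepend-zero z dep = record
    { weight = λ { zero → 0# ; (suc i) → weight i }
    ; nonNeg = λ { zero → inj₂ refl ; (suc i) → nonNeg i }
    ; supported = λ { zero _ → refl ; (suc i) → supported i }
    ; total = pos-resp (sym (+-identityˡ _)) total
    ; null = λ l → trans (+-congʳ (zeroˡ _)) (trans (+-identityˡ _) (null l))
    } where open Dependent dep

  -- Induction on the number of vectors. A nonzero active `z zero` leads to two recursive calls: on
  -- the remaining vectors, and, if the separator `u` found there is not negative on `z zero`, on
  -- their projections along `z zero`. Either outcome of the second call can be lifted back.
  gordan : ∀ {n D} (z : Fin n → Vector Carrier D) (B : Subset n) → Separated z B ⊎ Dependent z B
  gordan z [] = inj₁ ((λ _ → 0#) , λ ())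
  gordan z (outside ∷ B) with gordan (λ i → z (suc i)) B
  ... | inj₁ (u , h) = inj₁ (u , λ { (suc i) → h i })
  ... | inj₂ dep = inj₂ (prepend-zero z dep)
  gordan {suc n} z (inside ∷ B) with zero⊎pivot (z zero)
  ... | inj₁ z₀≈0 = inj₂ record
        { weight = λ { zero → 1# ; (suc i) → 0# }
        ; nonNeg = λ { zero → inj₁ pos-1 ; (suc i) → inj₂ refl }
        ; supported = λ { (suc i) _ → refl }
        ; total = pos+nonNeg pos-1 (sum-nonNeg {n} (λ _ → inj₂ refl))
        ; null = λ l → trans (+-cong (trans (*-congˡ (z₀≈0 l)) (zeroʳ _)) (sum-zero {n} (λ i → zeroˡ (z (suc i) l)))) (+-identityˡ 0#)
        }
  gordan {D = suc D} z (inside ∷ B) | inj₂ (k , zk≉0) with gordan (λ i → z (suc i)) B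
  ... | inj₂ dep = inj₂ (prepend-zero z dep)
  ... | inj₁ (u , u<0) with nonNeg⊎neg (u · z zero)
  ...   | inj₂ u·z₀<0 = inj₁ (u , λ { zero _ → u·z₀<0 ; (suc i) → u<0 i })
  ...   | inj₁ u·z₀≥0 with gordan (λ i → Projection.project (z zero) k (z (suc i))) B
  ...     | inj₁ (g , g<0) = inj₁ (h , λ
        { zero _ → pos-resp
            (sym (trans (-‿cong (trans (h-· (z zero)) (+-congʳ (trans (*-congˡ (lift-·-self g)) (zeroʳ K)))))
                 (solve 2 (λ M x → :- (con (ℤ.+ 0) :+ :- M :* x) := M :* x) refl M (z zero · z zero))))
            (pos*pos M>0 (self-·-pos (z zero) k zk≉0))
        ; (suc i) i∈B → pos-resp
            (trans (solve 4 (λ K M a b → K :* (:- a) :+ M :* b := :- (K :* a :+ :- M :* b))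
                      refl K M (lift g · z (suc i)) (z zero · z (suc i)))
                   (-‿cong (sym (h-· (z (suc i))))))
            (h>0 i i∈B) })
    where
      open Projection (z zero) k
      -- `lift g` is negative on the remaining active vectors but vanishes on `z zero`. Subtracting
      -- a small multiple of `z zero` makes it negative there too, and `dominate` supplies a ratio
      -- of `M` to `K` small enough to keep the other signs.
      dom = dominate B (λ i → - (lift g · z (suc i))) (λ i → z zero · z (suc i))
              (λ i i∈B → neg-resp (sym (lift-· g (z (suc i)))) (g<0 i i∈B))
      K = proj₁ dom
      M = proj₁ (proj₂ dom)
      M>0 = proj₁ (proj₂ (proj₂ (proj₂ dom)))
      h>0 = proj₂ (proj₂ (proj₂ (proj₂ dom)))
      h : Vector Carrier (suc D)
      h l = K * lift g l + (- M) * z zero l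
      h-· : ∀ y → h · y ≈ K * (lift g · y) + (- M) * (z zero · y)
      h-· = ·-linearˡ K (- M) (lift g) (z zero)
  -- The dependence says s W = c z₀ for W = Σ wᵢ zᵢ; since u is negative on W but not on z₀, c < 0.
  ...     | inj₂ dep = inj₂ record
        { weight = λ { zero → - c ; (suc i) → s * weight i }
        ; nonNeg = λ { zero → inj₁ c<0 ; (suc i) → nonNeg*nonNeg (inj₁ s>0) (nonNeg i) }
        ; supported = λ { (suc i) i∉B → trans (*-congˡ (supported i i∉B)) (zeroʳ s) }
        ; total = pos+nonNeg c<0 (sum-nonNeg (λ i → nonNeg*nonNeg (inj₁ s>0) (nonNeg i)))
        ; null = λ l → begin
            - c * z zero l + sum (λ i → s * weight i * z (suc i) l)
              ≈⟨ +-congˡ (sum-cong-≋ (λ i → *-assoc s (weight i) (z (suc i) l))) ⟩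
            - c * z zero l + sum (λ i → s * (weight i * z (suc i) l))
              ≈⟨ +-congˡ (*-distribˡ-sum s (λ i → weight i * z (suc i) l)) ⟨
            - c * z zero l + s * W l
              ≈⟨ +-congˡ (sW≈cz₀ l) ⟩
            - c * z zero l + c * z zero l
              ≈⟨ solve 2 (λ c x → :- c :* x :+ c :* x := con (ℤ.+ 0)) refl c (z zero l) ⟩
            0# ∎
        }
    where
      open Projection (z zero) k
      open Dependent dep
      W : Vector Carrier (suc D)
      W l = sum (λ i → weight i * z (suc i) l)
      c = z zero k * W k
      s>0 : Pos s
      s>0 = square-pos zk≉0
      sW≈cz₀ : ∀ l → s * W l ≈ c * z zero l
      sW≈cz₀ = project-kernel W (λ l → trans (sym (project-sum weight (λ i → z (suc i)) l)) (null l))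
      u·W<0 : Neg (u · W)
      u·W<0 = neg-resp (sym (·-sum u weight (λ i → z (suc i)))) (weighted-neg B nonNeg supported total u<0)
      s[u·W]≈c[u·z₀] : s * (u · W) ≈ c * (u · z zero)
      s[u·W]≈c[u·z₀] = begin
        s * (u · W)                         ≈⟨ *-distribˡ-sum s (λ l → u l * W l) ⟩
        sum (λ l → s * (u l * W l))         ≈⟨ sum-cong-≋ (λ l → begin
          s * (u l * W l)        ≈⟨ solve 3 (λ s u w → s :* (u :* w) := u :* (s :* w)) refl s (u l) (W l) ⟩
          u l * (s * W l)        ≈⟨ *-congˡ (sW≈cz₀ l) ⟩
          u l * (c * z zero l)   ≈⟨ solve 3 (λ s u w → u :* (s :* w) := s :* (u :* w)) refl c (u l) (z zero l) ⟩
          c * (u l * z zero l)   ∎) ⟩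
        sum (λ l → c * (u l * z zero l))    ≈⟨ *-distribˡ-sum c (λ l → u l * z zero l) ⟨
        c * (u · z zero)                    ∎
      c<0 : Neg c
      c<0 with nonNeg⊎neg c
      ... | inj₂ n = n
      ... | inj₁ p = ⊥-elim (neg⇒¬nonNeg (neg-resp s[u·W]≈c[u·z₀] (pos*neg s>0 u·W<0))
                                         (nonNeg*nonNeg p u·z₀≥0))

  -- Sign patterns of linear functionals on a finite family

  HasSign : Bool → Carrier → Set
  HasSign true x = NonNeg x
  HasSign false x = Neg x

  -- `S` is the section by a closed half-space. Zero counts as nonnegative, so that the sections of
  -- functionals with sum zero cover every point, while strict separation keeps a point out of the
  -- section of its class.
  HasPattern : ∀ {n D} → (Fin n → Vector Carrier D) → Vector Carrier D → Subset n → Set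
  HasPattern y u S = ∀ i → HasSign (lookup S i) (u · y i)

  pattern-of : ∀ {n D} (y : Fin n → Vector Carrier D) u → ∃[ S ] HasPattern y u S
  pattern-of {zero} y u = [] , λ ()
  pattern-of {suc n} y u with pattern-of (λ i → y (suc i)) u | nonNeg⊎neg (u · y zero)
  ... | S , h | inj₁ p = true ∷ S , λ { zero → p ; (suc i) → h i }
  ... | S , h | inj₂ p = false ∷ S , λ { zero → p ; (suc i) → h i }

  sign-combination : ∀ β {a b x y} → Pos a → NonNeg b → HasSign β x → HasSign β y → HasSign β (a * x + b * y)
  sign-combination true p q m n = nonNeg+nonNeg (nonNeg*nonNeg (inj₁ p) m) (nonNeg*nonNeg q n)
  sign-combination false p q m n = pos*neg+nonNeg*neg p q m n

  sign-scale : ∀ β {s x} → Pos s → HasSign β x → HasSign β (s * x)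
  sign-scale true p q = nonNeg*nonNeg (inj₁ p) q
  sign-scale false p q = pos*neg p q

  sign-resp : ∀ β {x y} → x ≈ y → HasSign β x → HasSign β y
  sign-resp true = nonNeg-resp
  sign-resp false = neg-resp

  -- If a pattern S of the other points extends to both signs at y zero, an interpolated functional
  -- vanishes at y zero and still has pattern S; so S is a pattern of the projections along y zero.
  interpolate : ∀ {n D} (y : Fin (suc n) → Vector Carrier (suc D)) k → ¬ (y zero k ≈ 0#) → ∀ u u′ S →
    HasPattern y u (true ∷ S) → HasPattern y u′ (false ∷ S) →
    ∃[ g ] HasPattern (λ i → Projection.project (y zero) k (y (suc i))) g S
  interpolate {D = D} y k yk≉0 u u′ S hu hu′ = removeAt h k , λ i →
    sign-resp (lookup S i) (sym (restrict-· h (y (suc i)) h·y₀≈0))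
      (sign-scale (lookup S i) (square-pos yk≉0)
        (sign-resp (lookup S i) (sym (h-· (y (suc i))))
          (sign-combination (lookup S i) (hu′ zero) (hu zero) (hu (suc i)) (hu′ (suc i)))))
    where
      open Projection (y zero) k
      a = - (u′ · y zero)
      b = u · y zero
      h : Vector Carrier (suc D)
      h l = a * u l + b * u′ l
      h-· : ∀ x → h · x ≈ a * (u · x) + b * (u′ · x)
      h-· = ·-linearˡ a b u u′
      h·y₀≈0 : h · y zero ≈ 0#
      h·y₀≈0 = trans (h-· (y zero))
        (solve 2 (λ p q → :- p :* q :+ q :* p := con (ℤ.+ 0)) refl (u′ · y zero) (u · y zero))

  IsPatternList : ∀ {n D} → (Fin n → Vector Carrier D) → List (Subset n) → Set
  IsPatternList y 𝓛 = ∀ u S → HasPattern y u S → S ∈ 𝓛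

  module _ (em : ExcludedMiddle 0ℓ) {n D} (y : Fin (suc n) → Vector Carrier (suc D)) (k : Fin (suc D))
           (yk≉0 : ¬ (y zero k ≈ 0#)) where

    Extendable : Subset n → Set
    Extendable S = ∃[ u ] HasPattern y u (true ∷ S)

    -- Each pattern of the remaining points receives one extension, `true` whenever that is
    -- realisable. The other one is missing only if both signs occur, and then `interpolate` finds
    -- `S` among the patterns of the projected points.
    extend : Subset n → Subset (suc n)
    extend S = does (em {Extendable S}) ∷ S

    extend-complete : ∀ {𝓛 𝓛′} → IsPatternList (λ i → y (suc i)) 𝓛 →
      IsPatternList (λ i → Projection.project (y zero) k (y (suc i))) 𝓛′ →
      IsPatternList y (List.map extend 𝓛 ++ List.map (false ∷_) 𝓛′)
    extend-complete {𝓛} {𝓛′} c c′ u (β ∷ S) h =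
      go β h em (∈-map⁺ extend (c u S (λ i → h (suc i))))
      where
        go : ∀ β → HasPattern y u (β ∷ S) → (ext? : Dec (Extendable S)) →
             (does ext? ∷ S) ∈ List.map extend 𝓛 →
             (β ∷ S) ∈ List.map extend 𝓛 ++ List.map (false ∷_) 𝓛′
        go true h (yes _) ext = ∈-++⁺ˡ ext
        go true h (no none) ext = ⊥-elim (none (u , h))
        go false h (no _) ext = ∈-++⁺ˡ ext
        go false h (yes (u⁺ , h⁺)) ext =
          let g , hg = interpolate y k yk≉0 u⁺ u S h⁺ h
          in ∈-++⁺ʳ (List.map extend 𝓛) (∈-map⁺ (false ∷_) (c′ g S hg))

    extend-length : ∀ 𝓛 𝓛′ → List.length 𝓛 ℕ.≤ suc n ℕ.^ suc D → List.length 𝓛′ ℕ.≤ suc n ℕ.^ D →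
      List.length (List.map extend 𝓛 ++ List.map (false ∷_) 𝓛′) ℕ.≤ suc (suc n) ℕ.^ suc D
    extend-length 𝓛 𝓛′ small small′ = ℕ.≤-trans
      (ℕ.≤-reflexive (≡.trans (length-++ (List.map extend 𝓛))
        (≡.cong₂ ℕ._+_ (length-map extend 𝓛) (length-map (false ∷_) 𝓛′))))
      (ℕ.≤-trans (ℕ.+-mono-≤ small small′) (power-step n D))

  -- Deletion and restriction for the hyperplane arrangement dual to the points. A zero vector lies
  -- on the nonnegative side of every functional and splits no pattern; in dimension zero all
  -- vectors are of this kind.
  patterns : ExcludedMiddle 0ℓ → ∀ n D (y : Fin n → Vector Carrier D) →
    Σ[ 𝓛 ∈ List (Subset n) ] List.length 𝓛 ℕ.≤ suc n ℕ.^ D × IsPatternList y 𝓛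
  patterns em zero D y = [] ∷ [] , ℕ.≤-reflexive (≡.sym (ℕ.^-zeroˡ D)) , λ { _ [] _ → here ≡.refl }
  patterns em (suc n) D y with zero⊎pivot (y zero)
  patterns em (suc n) D y | inj₁ y₀≈0 with patterns em n D (λ i → y (suc i))
  ... | 𝓛 , small , complete =
    List.map (true ∷_) 𝓛 ,
    ℕ.≤-trans (ℕ.≤-reflexive (length-map (true ∷_) 𝓛)) (ℕ.≤-trans small (ℕ.^-monoˡ-≤ D (ℕ.n≤1+n (suc n)))) ,
    λ { u (true ∷ S) h → ∈-map⁺ (true ∷_) (complete u S (λ i → h (suc i)))
      ; u (false ∷ S) h → ⊥-elim (neg⇒¬nonNeg (h zero) (inj₂ (·-zeroʳ u y₀≈0))) }
  patterns em (suc n) (suc D) y | inj₂ (k , yk≉0)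
    with patterns em n (suc D) (λ i → y (suc i)) | patterns em n D (λ i → Projection.project (y zero) k (y (suc i)))
  ... | 𝓛 , small , complete | 𝓛′ , small′ , complete′ =
    List.map (extend em y k yk≉0) 𝓛 ++ List.map (false ∷_) 𝓛′ ,
    extend-length em y k yk≉0 𝓛 𝓛′ small small′ , extend-complete em y k yk≉0 complete complete′

-- Balanced colourings

module Colouring where
  open import Algebra.Properties.Semiring.Sum ℕ.+-*-semiring
  open import Data.List.Membership.Propositional using (_∈_)
  open import Data.List.Relation.Unary.Any as Any using ()
  open import Data.List.Relation.Unary.Any.Properties using (lookup-index)
  open import Data.Nat
  open import Data.Nat.DivMod using (m≡m%n+[m/n]*n; m%n<n; /-monoˡ-≤; m*n/n≡m)
  open import Data.Nat.Properties
  open ≡ using (refl; sym; trans; cong; cong₂; subst; subst₂)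

  sum-const : ∀ n b → sum {n} (λ _ → b) ≡ n * b
  sum-const zero b = refl
  sum-const (suc n) b = cong (b +_) (sum-const n b)

  sum-mono : ∀ {n} {f g : Fin n → ℕ} → (∀ i → f i ≤ g i) → sum f ≤ sum g
  sum-mono {zero} h = z≤n
  sum-mono {suc n} h = +-mono-≤ (h zero) (sum-mono (h ∘ suc))

  term≤sum : ∀ {n} (f : Fin n → ℕ) i → f i ≤ sum f
  term≤sum f zero = m≤m+n _ _
  term≤sum f (suc i) = ≤-trans (term≤sum (f ∘ suc) i) (m≤n+m _ _)

  sum-if : ∀ {n} (j : Fin (suc n)) a b → sum (λ c → if does (c Fin.≟ j) then a else b) ≡ a + n * b
  sum-if {n} zero a b = cong (a +_) (sum-const n b)
  sum-if {suc n} (suc j) a b = trans (cong (b +_) (sum-if j a b)) (rearrange a b (n * b))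
    where
      rearrange : ∀ a b c → b + (a + c) ≡ a + (b + c)
      rearrange = solve-∀

  small-or-large : ∀ n (f : Fin n → ℕ) m → (∃[ c ] f c ≤ m) ⊎ n * suc m ≤ sum f
  small-or-large zero f m = inj₂ z≤n
  small-or-large (suc n) f m with f zero ≤? m
  ... | yes f₀≤m = inj₁ (zero , f₀≤m)
  ... | no f₀≰m with small-or-large n (f ∘ suc) m
  ...   | inj₁ (c , fc≤m) = inj₁ (suc c , fc≤m)
  ...   | inj₂ large = inj₂ (+-mono-≤ (≰⇒> f₀≰m) large)

  average : ∀ {n} (f : Fin (suc n) → ℕ) m → sum f ≤ suc n * m → ∃[ c ] f c ≤ m
  average {n} f m Σf≤ with small-or-large (suc n) f m
  ... | inj₁ found = found
  ... | inj₂ large = ⊥-elim (1+n≰n (*-cancelˡ-≤ (suc n) (≤-trans large Σf≤)))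

  -- Colour counts and the exponential potential

  hits misses : ∀ {r n} → Fin r → Vec (Fin r) n → Subset n → ℕ
  hits j [] [] = 0
  hits j (c ∷ χ) (β ∷ S) = (if β ∧ does (c Fin.≟ j) then 1 else 0) + hits j χ S
  misses j [] [] = 0
  misses j (c ∷ χ) (β ∷ S) = (if β ∧ not (does (c Fin.≟ j)) then 1 else 0) + misses j χ S

  off : ∀ {n} → Subset n → ℕ
  off [] = 0
  off (β ∷ S) = (if β then 0 else 1) + off S

  hits+misses : ∀ {r n} (j : Fin r) (χ : Vec (Fin r) n) S → hits j χ S + misses j χ S ≡ card S
  hits+misses j [] [] = refl
  hits+misses j (c ∷ χ) (false ∷ S) = hits+misses j χ S
  hits+misses j (c ∷ χ) (true ∷ S) with does (c Fin.≟ j)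
  ... | true = cong suc (hits+misses j χ S)
  ... | false = trans (+-suc _ _) (cong suc (hits+misses j χ S))

  card+off : ∀ {n} (S : Subset n) → card S + off S ≡ n
  card+off [] = refl
  card+off (true ∷ S) = cong suc (card+off S)
  card+off (false ∷ S) = trans (+-suc _ _) (cong suc (card+off S))

  -- Method of conditional expectations. An item (j , S) pays a factor a for every point of S of
  -- colour j and suc K for every other point of S; with K = r′ + a these average to K over the colours.
  module Potential (r′ a : ℕ) where

    K : ℕ
    K = r′ + a

    factor : Fin (suc r′) → Fin (suc r′) → Bool → ℕ
    factor j c true = if does (c Fin.≟ j) then a else suc K
    factor j c false = K

    value : ∀ {n} → Fin (suc r′) → Vec (Fin (suc r′)) n → Subset n → ℕ
    value j [] [] = 1
    value j (c ∷ χ) (β ∷ S) = factor j c β * value j χ S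

    sum-factor : ∀ j β → sum (λ c → factor j c β) ≡ suc r′ * K
    sum-factor j true = trans (sum-if j a (suc K)) (identity a r′)
      where
        identity : ∀ a r → a + r * suc (r + a) ≡ suc r * (r + a)
        identity = solve-∀
    sum-factor j false = sum-const (suc r′) K

    value-power : ∀ {n} j (χ : Vec (Fin (suc r′)) n) S →
      value j χ S ≡ a ^ hits j χ S * suc K ^ misses j χ S * K ^ off S
    value-power j [] [] = refl
    value-power j (c ∷ χ) (β ∷ S) with value-power j χ S
    value-power j (c ∷ χ) (false ∷ S) | ih =
      trans (cong (K *_) ih) (shift K (a ^ hits j χ S) (suc K ^ misses j χ S) (K ^ off S))
      where
        shift : ∀ k x y z → k * (x * y * z) ≡ x * y * (k * z)
        shift = solve-∀
    value-power j (c ∷ χ) (true ∷ S) | ih with does (c Fin.≟ j)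
    ... | true = trans (cong (a *_) ih) (shift a (a ^ hits j χ S) (suc K ^ misses j χ S) (K ^ off S))
      where
        shift : ∀ k x y z → k * (x * y * z) ≡ k * x * y * z
        shift = solve-∀
    ... | false = trans (cong (suc K *_) ih) (shift (suc K) (a ^ hits j χ S) (suc K ^ misses j χ S) (K ^ off S))
      where
        shift : ∀ k x y z → k * (x * y * z) ≡ x * (k * y) * z
        shift = solve-∀

    sum-weighted-factor : ∀ {N} (w : Fin N → ℕ) (col : Fin N → Fin (suc r′)) (β : Fin N → Bool) →
      sum (λ c → sum (λ x → w x * factor (col x) c (β x))) ≡ suc r′ * (K * sum w)
    sum-weighted-factor w col β = begin
      sum (λ c → sum (λ x → w x * factor (col x) c (β x)))  ≡⟨ ∑-comm (λ c x → w x * factor (col x) c (β x)) ⟩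
      sum (λ x → sum (λ c → w x * factor (col x) c (β x)))  ≡⟨ sum-cong-≗ (λ x → *-distribˡ-sum (w x) (λ c → factor (col x) c (β x))) ⟨
      sum (λ x → w x * sum (λ c → factor (col x) c (β x)))  ≡⟨ sum-cong-≗ (λ x → cong (w x *_) (sum-factor (col x) (β x))) ⟩
      sum (λ x → w x * (suc r′ * K))                        ≡⟨ *-distribʳ-sum (suc r′ * K) w ⟨
      sum w * (suc r′ * K)                                  ≡⟨ *-comm (sum w) _ ⟩
      suc r′ * K * sum w                                    ≡⟨ *-assoc (suc r′) K (sum w) ⟩
      suc r′ * (K * sum w)                                  ∎
      where open ≡-Reasoning

    -- The weights `w` carry the factors already paid for earlier points, which is why the induction
    -- needs them arbitrary. Some colour of the next point does no worse than the mean over the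
    -- colours, and the mean multiplies the total by exactly `K`.
    low-potential : ∀ n {N} (w : Fin N → ℕ) (col : Fin N → Fin (suc r′)) (S : Fin N → Subset n) →
      Σ[ χ ∈ Vec (Fin (suc r′)) n ] sum (λ x → w x * value (col x) χ (S x)) ≤ K ^ n * sum w
    low-potential zero w col S = [] , ≤-reflexive (trans
      (sum-cong-≗ (λ x → trans (cong (w x *_) (value-[] (col x) (S x))) (*-identityʳ (w x)))) (sym (*-identityˡ _)))
      where
        value-[] : ∀ j S → value j [] S ≡ 1
        value-[] j [] = refl
    low-potential (suc n) {N} w col S
      with average (λ c → sum (λ x → w x * factor (col x) c (Vec.head (S x)))) (K * sum w)
             (≤-reflexive (sum-weighted-factor w col (Vec.head ∘ S)))
    ... | c , small with low-potential n (λ x → w x * factor (col x) c (Vec.head (S x))) col (Vec.tail ∘ S)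
    ...   | χ , rest = c ∷ χ , (begin
      sum (λ x → w x * value (col x) (c ∷ χ) (S x))
        ≡⟨ sum-cong-≗ (λ x → split-value (w x) (col x) (S x)) ⟩
      sum (λ x → w x * factor (col x) c (Vec.head (S x)) * value (col x) χ (Vec.tail (S x)))
        ≤⟨ rest ⟩
      K ^ n * sum (λ x → w x * factor (col x) c (Vec.head (S x)))
        ≤⟨ *-monoʳ-≤ (K ^ n) small ⟩
      K ^ n * (K * sum w)
        ≡⟨ rearrange (K ^ n) K (sum w) ⟩
      K * K ^ n * sum w ∎)
      where
        open ≤-Reasoning
        rearrange : ∀ x y z → x * (y * z) ≡ y * x * z
        rearrange = solve-∀
        split-value : ∀ w j S → w * value j (c ∷ χ) S ≡ w * factor j c (Vec.head S) * value j χ (Vec.tail S)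
        split-value w j (β ∷ S) = sym (*-assoc w _ _)

    -- The items are pairs of a listed set and a colour, coded by `combine`. They all start with
    -- weight 1, and each single term is at most the total.
    balanced-value : ∀ {n} (𝓛 : List (Subset n)) →
      Σ[ χ ∈ Vec (Fin (suc r′)) n ]
        (∀ {S} → S ∈ 𝓛 → ∀ j → value j χ S ≤ K ^ n * (List.length 𝓛 * suc r′))
    balanced-value {n} 𝓛 = proj₁ pot , λ {S} S∈𝓛 j → begin
      value j χ S
        ≡⟨ cong (value j χ) (lookup-index S∈𝓛) ⟩
      value j χ (List.lookup 𝓛 (Any.index S∈𝓛))
        ≡⟨ cong (λ ix → value (proj₂ ix) χ (List.lookup 𝓛 (proj₁ ix))) (remQuot-combine (Any.index S∈𝓛) j) ⟨
      value (col (Fin.combine (Any.index S∈𝓛) j)) χ (set (Fin.combine (Any.index S∈𝓛) j))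
        ≡⟨ *-identityˡ _ ⟨
      1 * value (col (Fin.combine (Any.index S∈𝓛) j)) χ (set (Fin.combine (Any.index S∈𝓛) j))
        ≤⟨ term≤sum (λ x → 1 * value (col x) χ (set x)) (Fin.combine (Any.index S∈𝓛) j) ⟩
      sum (λ x → 1 * value (col x) χ (set x))
        ≤⟨ proj₂ pot ⟩
      K ^ n * sum {List.length 𝓛 * suc r′} (λ _ → 1)
        ≡⟨ cong (K ^ n *_) (trans (sum-const (List.length 𝓛 * suc r′) 1) (*-identityʳ _)) ⟩
      K ^ n * (List.length 𝓛 * suc r′) ∎
      where
        open ≤-Reasoning
        col : Fin (List.length 𝓛 * suc r′) → Fin (suc r′)
        col x = proj₂ (Fin.remQuot {List.length 𝓛} (suc r′) x)
        set : Fin (List.length 𝓛 * suc r′) → Subset n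
        set x = List.lookup 𝓛 (proj₁ (Fin.remQuot {List.length 𝓛} (suc r′) x))
        pot = low-potential n (λ _ → 1) col set
        χ = proj₁ pot

  -- Bernoulli's inequality (1 + 1/K)^m ≥ 1 + m/K, cleared of denominators.
  bernoulli : ∀ K m → K ^ m * (K + m) ≤ suc K ^ m * K
  bernoulli K zero = ≤-reflexive (cong (_+ 0) (+-identityʳ K))
  bernoulli K (suc m) = begin
    K * K ^ m * (K + suc m)                  ≤⟨ m≤m+n _ (K ^ m * m) ⟩
    K * K ^ m * (K + suc m) + K ^ m * m      ≡⟨ expand K (K ^ m) m ⟩
    suc K * (K ^ m * (K + m))                ≤⟨ *-monoʳ-≤ (suc K) (bernoulli K m) ⟩
    suc K * (suc K ^ m * K)                  ≡⟨ *-assoc (suc K) (suc K ^ m) K ⟨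
    suc K ^ suc m * K                        ∎
    where
      open ≤-Reasoning
      expand : ∀ K x m → K * x * (K + suc m) + x * m ≡ suc K * (x * (K + m))
      expand = solve-∀

  -- (1 − 1/M)^L ≥ 1 − L/M for M = suc M′, with e = M − L.
  bernoulli-below : ∀ L e M′ → suc M′ ≡ L + e → suc M′ ^ L * e ≤ M′ ^ L * suc M′
  bernoulli-below zero e M′ eq = ≤-reflexive (cong (_+ 0) (sym eq))
  bernoulli-below (suc L) e M′ eq = begin
    suc M′ * suc M′ ^ L * e           ≡⟨ expand M′ (suc M′ ^ L) e ⟩
    suc M′ ^ L * (M′ * e + e)         ≤⟨ *-monoʳ-≤ (suc M′ ^ L) (+-monoʳ-≤ (M′ * e) e≤M′) ⟩
    suc M′ ^ L * (M′ * e + M′)        ≡⟨ expand′ M′ (suc M′ ^ L) e ⟩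
    M′ * (suc M′ ^ L * suc e)         ≤⟨ *-monoʳ-≤ M′ (bernoulli-below L (suc e) M′ (trans eq (sym (+-suc L e)))) ⟩
    M′ * (M′ ^ L * suc M′)            ≡⟨ *-assoc M′ (M′ ^ L) (suc M′) ⟨
    M′ * M′ ^ L * suc M′              ∎
    where
      open ≤-Reasoning
      e≤M′ : e ≤ M′
      e≤M′ = ≤-trans (m≤n+m e L) (≤-reflexive (sym (suc-injective eq)))
      expand : ∀ M x e → suc M * x * e ≡ x * (M * e + e)
      expand = solve-∀
      expand′ : ∀ M x e → x * (M * e + M) ≡ M * (x * suc e)
      expand′ = solve-∀

  ^-distribʳ-* : ∀ m n o → (m * n) ^ o ≡ m ^ o * n ^ o
  ^-distribʳ-* m n zero = refl
  ^-distribʳ-* m n (suc o) = trans (cong (m * n *_) (^-distribʳ-* m n o)) (interchange m n (m ^ o) (n ^ o))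
    where
      interchange : ∀ m n x y → m * n * (x * y) ≡ m * x * (n * y)
      interchange = solve-∀

  -- Bernoulli applied to (1 + 1/Q)^m with m ≈ n / (e + 1), then raised to the power e + 1.
  exponential-beats-polynomial : ∀ q C e → ∃[ n₀ ] (∀ n → n ≥ n₀ →
    suc q ^ n * (C * suc n ^ e) < suc (suc q) ^ n)
  exponential-beats-polynomial q C e = m₀ * suc e , beats
    where
      open ≤-Reasoning
      Q b m₀ : ℕ
      Q = suc q
      b = suc Q
      -- With n below `suc m * suc e`, the polynomial times `Q ^ suc e` is at most `m₀ * suc m ^ e`,
      -- which falls below `suc m ^ suc e` as soon as `m₀ ≤ m`.
      m₀ = Q ^ suc e * (C * suc e ^ e)

      split-power : ∀ x t m → x ^ (t + m * suc e) ≡ x ^ t * (x ^ m) ^ suc e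
      split-power x t m = trans (^-distribˡ-+-* x t (m * suc e)) (cong (x ^ t *_) (sym (^-*-assoc x m (suc e))))

      growth : ∀ t m → Q ^ (t + m * suc e) * (Q + m) ^ suc e ≤ b ^ (t + m * suc e) * Q ^ suc e
      growth t m = begin
        Q ^ (t + m * suc e) * (Q + m) ^ suc e
          ≡⟨ cong (_* (Q + m) ^ suc e) (split-power Q t m) ⟩
        Q ^ t * (Q ^ m) ^ suc e * (Q + m) ^ suc e
          ≡⟨ *-assoc (Q ^ t) ((Q ^ m) ^ suc e) ((Q + m) ^ suc e) ⟩
        Q ^ t * ((Q ^ m) ^ suc e * (Q + m) ^ suc e)
          ≡⟨ cong (Q ^ t *_) (^-distribʳ-* (Q ^ m) (Q + m) (suc e)) ⟨
        Q ^ t * (Q ^ m * (Q + m)) ^ suc e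
          ≤⟨ *-mono-≤ (^-monoˡ-≤ t (n≤1+n Q)) (^-monoˡ-≤ (suc e) (bernoulli Q m)) ⟩
        b ^ t * (b ^ m * Q) ^ suc e
          ≡⟨ cong (b ^ t *_) (^-distribʳ-* (b ^ m) Q (suc e)) ⟩
        b ^ t * ((b ^ m) ^ suc e * Q ^ suc e)
          ≡⟨ *-assoc (b ^ t) ((b ^ m) ^ suc e) (Q ^ suc e) ⟨
        b ^ t * (b ^ m) ^ suc e * Q ^ suc e
          ≡⟨ cong (_* Q ^ suc e) (split-power b t m) ⟨
        b ^ (t + m * suc e) * Q ^ suc e ∎

      base : ∀ t m → t ≤ e → m₀ ≤ m → C * suc (t + m * suc e) ^ e * Q ^ suc e < (Q + m) ^ suc e
      base t m t≤e m₀≤m = begin-strict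
        C * suc (t + m * suc e) ^ e * Q ^ suc e
          ≤⟨ *-monoˡ-≤ (Q ^ suc e) (*-monoʳ-≤ C (^-monoˡ-≤ e (s≤s (+-monoˡ-≤ (m * suc e) t≤e)))) ⟩
        C * (suc m * suc e) ^ e * Q ^ suc e
          ≡⟨ cong (λ x → C * x * Q ^ suc e) (^-distribʳ-* (suc m) (suc e) e) ⟩
        C * (suc m ^ e * suc e ^ e) * Q ^ suc e
          ≡⟨ rearrange C (suc m ^ e) (suc e ^ e) (Q ^ suc e) ⟩
        m₀ * suc m ^ e
          <⟨ *-monoˡ-< (suc m ^ e) {{m^n≢0 (suc m) e}} (s≤s m₀≤m) ⟩
        suc m * suc m ^ e
          ≤⟨ ^-monoˡ-≤ (suc e) (s≤s (m≤n+m m q)) ⟩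
        (Q + m) ^ suc e ∎
        where
          rearrange : ∀ c x y z → c * (x * y) * z ≡ z * (c * y) * x
          rearrange = solve-∀

      beats-at : ∀ t m → t ≤ e → m₀ ≤ m →
        Q ^ (t + m * suc e) * (C * suc (t + m * suc e) ^ e) < b ^ (t + m * suc e)
      beats-at t m t≤e m₀≤m = *-cancelʳ-< (Q ^ suc e) _ _ (begin-strict
        Q ^ (t + m * suc e) * (C * suc (t + m * suc e) ^ e) * Q ^ suc e
          ≡⟨ *-assoc (Q ^ (t + m * suc e)) _ _ ⟩
        Q ^ (t + m * suc e) * (C * suc (t + m * suc e) ^ e * Q ^ suc e)
          <⟨ *-monoʳ-< (Q ^ (t + m * suc e)) {{m^n≢0 Q (t + m * suc e)}} (base t m t≤e m₀≤m) ⟩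
        Q ^ (t + m * suc e) * (Q + m) ^ suc e
          ≤⟨ growth t m ⟩
        b ^ (t + m * suc e) * Q ^ suc e ∎)

      beats : ∀ n → n ≥ m₀ * suc e → Q ^ n * (C * suc n ^ e) < b ^ n
      beats n n≥n₀ = subst (λ n → Q ^ n * (C * suc n ^ e) < b ^ n) (sym (m≡m%n+[m/n]*n n (suc e)))
        (beats-at (n % suc e) (n / suc e) (s≤s⁻¹ (m%n<n n (suc e)))
          (≤-trans (≤-reflexive (sym (m*n/n≡m m₀ (suc e)))) (/-monoˡ-≤ (suc e) n≥n₀)))

  -- Choice of the parameters: a potential bound N K^n forces the discrepancy below n / L
  -- as soon as N^L < (1 + 1/Q)^n.
  module Parameters (r′ L : ℕ) where

    a K b M′ M Q : ℕ
    -- Chosen for `M * (r′ * r′) ≤ K * K`: `M` grows linearly with `K`, so a large `a` suffices.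
    a = suc (r′ * r′ * (2 * L + 1))
    K = r′ + a
    b = suc K
    M′ = L * b
    M = suc M′
    Q = M ^ L * K

    instance
      K≢0 : NonZero K
      K≢0 = >-nonZero (≤-trans (s≤s z≤n) (m≤n+m a r′))

    Mr′²≤K² : M * (r′ * r′) ≤ K * K
    Mr′²≤K² = begin
      M * (r′ * r′)                    ≡⟨ expand L K (r′ * r′) ⟩
      r′ * r′ * (L * K + L * 1 + 1)    ≤⟨ *-monoʳ-≤ (r′ * r′) (+-mono-≤ (+-monoʳ-≤ (L * K) (*-monoʳ-≤ L 1≤K)) 1≤K) ⟩
      r′ * r′ * (L * K + L * K + K)    ≡⟨ collect L K (r′ * r′) ⟩
      r′ * r′ * (2 * L + 1) * K        ≤⟨ *-monoˡ-≤ K (≤-trans (n≤1+n _) (m≤n+m a r′)) ⟩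
      K * K                            ∎
      where
        open ≤-Reasoning
        1≤K : 1 ≤ K
        1≤K = >-nonZero⁻¹ K
        expand : ∀ L K x → suc (L * suc K) * x ≡ x * (L * K + L * 1 + 1)
        expand = solve-∀
        collect : ∀ L K x → x * (L * K + L * K + K) ≡ x * (2 * L + 1) * K
        collect = solve-∀

    M′K²≤ : M′ * (K * K) ≤ M * (a * (K + r′))
    M′K²≤ = +-cancelʳ-≤ (K * K) _ _ (begin
      M′ * (K * K) + K * K                     ≡⟨ difference-of-squares M′ r′ a ⟩
      M * (a * (K + r′)) + M * (r′ * r′)       ≤⟨ +-monoʳ-≤ (M * (a * (K + r′))) Mr′²≤K² ⟩
      M * (a * (K + r′)) + K * K               ∎)
      where
        open ≤-Reasoning
        difference-of-squares : ∀ m r a → m * ((r + a) * (r + a)) + (r + a) * (r + a) ≡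
                                          suc m * (a * (r + a + r)) + suc m * (r * r)
        difference-of-squares = solve-∀

    -- One hit together with `r′` misses is worth `a * b ^ r′`, against the neutral value
    -- `K ^ suc r′`. By Bernoulli and a = K - r′ the ratio is at least (K - r′)(K + r′)/K² = 1 -
    -- r′²/K², hence at least 1 - 1/M.
    hit-compensation : M′ * K ^ suc r′ ≤ M * (a * b ^ r′)
    hit-compensation = *-cancelʳ-≤ _ _ K (begin
      M′ * (K * K ^ r′) * K            ≡⟨ e₁ M′ K (K ^ r′) ⟩
      K ^ r′ * (M′ * (K * K))          ≤⟨ *-monoʳ-≤ (K ^ r′) M′K²≤ ⟩
      K ^ r′ * (M * (a * (K + r′)))    ≡⟨ e₂ (K ^ r′) M a (K + r′) ⟩
      M * a * (K ^ r′ * (K + r′))      ≤⟨ *-monoʳ-≤ (M * a) (bernoulli K r′) ⟩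
      M * a * (b ^ r′ * K)             ≡⟨ e₃ M a (b ^ r′) K ⟩
      M * (a * b ^ r′) * K             ∎)
      where
        open ≤-Reasoning
        e₁ : ∀ m k x → m * (k * x) * k ≡ x * (m * (k * k))
        e₁ = solve-∀
        e₂ : ∀ x m a y → x * (m * (a * y)) ≡ m * a * (x * y)
        e₂ = solve-∀
        e₃ : ∀ m a x k → m * a * (x * k) ≡ m * (a * x) * k
        e₃ = solve-∀

    -- By `bernoulli-below` it is enough that (1 - L/M)(1 + 1/K) > 1. The choice of `M` makes this
    -- hold by one unit: `suc (K * L) * b` is `suc (K * M)`. The strict inequality between integers
    -- yields the growth rate `suc Q` over `Q`.
    Q<M′^L*b : Q < M′ ^ L * b
    Q<M′^L*b = *-cancelʳ-< M _ _ (begin-strict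
      M ^ L * K * M                    ≡⟨ *-assoc (M ^ L) K M ⟩
      M ^ L * (K * M)                  <⟨ *-monoʳ-< (M ^ L) {{m^n≢0 M L}} (n<1+n (K * M)) ⟩
      M ^ L * suc (K * M)              ≡⟨ cong (M ^ L *_) (e₁ K L) ⟩
      M ^ L * (suc (K * L) * b)        ≡⟨ *-assoc (M ^ L) (suc (K * L)) b ⟨
      M ^ L * suc (K * L) * b          ≤⟨ *-monoˡ-≤ b (bernoulli-below L (suc (K * L)) M′ (e₂ K L)) ⟩
      M′ ^ L * M * b                   ≡⟨ e₃ (M′ ^ L) M b ⟩
      M′ ^ L * b * M                   ∎)
      where
        open ≤-Reasoning
        e₁ : ∀ K L → suc (K * suc (L * suc K)) ≡ suc (K * L) * suc K
        e₁ = solve-∀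
        e₂ : ∀ K L → suc (L * suc K) ≡ L + suc (K * L)
        e₂ = solve-∀
        e₃ : ∀ x y z → x * y * z ≡ x * z * y
        e₃ = solve-∀

    -- P, O, X stand for L p, L o and the excess L q − (r′ P + n).
    exponent-bound : ∀ P O X n → L * n ≡ P + (r′ * P + n + X) + O →
      M′ ^ (L * n) * b ^ n * K ^ (L * n) ≤ M ^ (L * n) * (a ^ P * b ^ (r′ * P + n + X) * K ^ O) * K ^ n
    exponent-bound P O X n eq = subst
      (λ Ln → M′ ^ Ln * b ^ n * K ^ Ln ≤ M ^ Ln * (a ^ P * b ^ (r′ * P + n + X) * K ^ O) * K ^ n) (sym eq) (begin
      M′ ^ (P + Z + O) * b ^ n * K ^ (P + Z + O)
        ≡⟨ cong₂ (λ x y → x * b ^ n * y) (split M′) K-split ⟩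
      M′ ^ P * (M′ ^ Z * M′ ^ O) * b ^ n * ((K ^ suc r′) ^ P * K ^ n * K ^ X * K ^ O)
        ≡⟨ e₁ (M′ ^ P) (M′ ^ Z * M′ ^ O) (b ^ n) ((K ^ suc r′) ^ P) (K ^ n) (K ^ X) (K ^ O) ⟩
      (M′ ^ P * (K ^ suc r′) ^ P) * (M′ ^ Z * M′ ^ O) * K ^ X * (b ^ n * K ^ n * K ^ O)
        ≡⟨ cong (λ x → x * (M′ ^ Z * M′ ^ O) * K ^ X * (b ^ n * K ^ n * K ^ O)) (^-distribʳ-* M′ (K ^ suc r′) P) ⟨
      (M′ * K ^ suc r′) ^ P * (M′ ^ Z * M′ ^ O) * K ^ X * (b ^ n * K ^ n * K ^ O)
        ≤⟨ *-monoˡ-≤ (b ^ n * K ^ n * K ^ O) (*-mono-≤ (*-mono-≤ (^-monoˡ-≤ P hit-compensation)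
             (*-mono-≤ (^-monoˡ-≤ Z (n≤1+n M′)) (^-monoˡ-≤ O (n≤1+n M′)))) (^-monoˡ-≤ X (n≤1+n K))) ⟩
      (M * (a * b ^ r′)) ^ P * (M ^ Z * M ^ O) * b ^ X * (b ^ n * K ^ n * K ^ O)
        ≡⟨ cong (λ x → x * (M ^ Z * M ^ O) * b ^ X * (b ^ n * K ^ n * K ^ O))
             (trans (^-distribʳ-* M (a * b ^ r′) P) (cong (M ^ P *_)
               (trans (^-distribʳ-* a (b ^ r′) P) (cong (a ^ P *_) (^-*-assoc b r′ P))))) ⟩
      M ^ P * (a ^ P * b ^ (r′ * P)) * (M ^ Z * M ^ O) * b ^ X * (b ^ n * K ^ n * K ^ O)
        ≡⟨ e₂ (M ^ P) (a ^ P) (b ^ (r′ * P)) (M ^ Z * M ^ O) (b ^ X) (b ^ n) (K ^ n) (K ^ O) ⟩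
      M ^ P * (M ^ Z * M ^ O) * (a ^ P * (b ^ (r′ * P) * b ^ n * b ^ X) * K ^ O) * K ^ n
        ≡⟨ cong₂ (λ x y → x * (a ^ P * y * K ^ O) * K ^ n) (split M) (split-Z b) ⟨
      M ^ (P + Z + O) * (a ^ P * b ^ Z * K ^ O) * K ^ n ∎)
      where
        open ≤-Reasoning
        Z : ℕ
        Z = r′ * P + n + X
        split : ∀ x → x ^ (P + Z + O) ≡ x ^ P * (x ^ Z * x ^ O)
        split x = trans (^-distribˡ-+-* x (P + Z) O) (trans (cong (_* x ^ O) (^-distribˡ-+-* x P Z)) (*-assoc (x ^ P) _ _))
        split-Z : ∀ x → x ^ Z ≡ x ^ (r′ * P) * x ^ n * x ^ X
        split-Z x = trans (^-distribˡ-+-* x (r′ * P + n) X) (cong (_* x ^ X) (^-distribˡ-+-* x (r′ * P) n))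
        K-split : K ^ (P + Z + O) ≡ (K ^ suc r′) ^ P * K ^ n * K ^ X * K ^ O
        K-split = trans (split K) (trans (cong (λ x → K ^ P * (x * K ^ O)) (split-Z K))
          (trans (e₀ (K ^ P) (K ^ (r′ * P)) (K ^ n) (K ^ X) (K ^ O))
            (cong (λ x → x * K ^ n * K ^ X * K ^ O)
              (trans (sym (^-distribˡ-+-* K P (r′ * P))) (sym (^-*-assoc K (suc r′) P))))))
          where
            e₀ : ∀ p q x y z → p * (q * x * y * z) ≡ p * q * x * y * z
            e₀ = solve-∀
        e₁ : ∀ m w u k x y z → m * w * u * (k * x * y * z) ≡ m * k * w * y * (u * x * z)
        e₁ = solve-∀
        e₂ : ∀ m a c w x u k z → m * (a * c) * w * x * (u * k * z) ≡ m * w * (a * (c * u * x) * z) * k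
        e₂ = solve-∀

    -- The `L`-th power turns an excess of n/L misses into the integer exponent `n`. Pairing each
    -- hit with `r′` misses costs at most a factor 1 - 1/M per hit, and the `n` surplus misses gain
    -- b/K each; together the `L`-th power of the value exceeds its neutral size by at least
    -- ((M′/M)^L b/K)^n.
    large-discrepancy : ∀ p q o n N → p + q + o ≡ n → a ^ p * b ^ q * K ^ o ≤ K ^ n * N →
      L * (r′ * p) + n ≤ L * q → suc Q ^ n ≤ Q ^ n * N ^ L
    large-discrepancy p q o n N n≡ value≤ large = begin
      suc Q ^ n
        ≤⟨ ^-monoˡ-≤ n Q<M′^L*b ⟩
      (M′ ^ L * b) ^ n
        ≡⟨ trans (^-distribʳ-* (M′ ^ L) b n) (cong (_* b ^ n) (^-*-assoc M′ L n)) ⟩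
      M′ ^ (L * n) * b ^ n
        ≤⟨ *-cancelʳ-≤ _ _ (K ^ (L * n)) {{m^n≢0 K (L * n)}} bound ⟩
      M ^ (L * n) * K ^ n * N ^ L
        ≡⟨ cong (_* N ^ L) (trans (^-distribʳ-* (M ^ L) K n) (cong (_* K ^ n) (^-*-assoc M L n))) ⟨
      Q ^ n * N ^ L ∎
      where
        open ≤-Reasoning
        X : ℕ
        X = L * q ∸ (r′ * (p * L) + n)
        Lq≡ : q * L ≡ r′ * (p * L) + n + X
        Lq≡ = trans (*-comm q L) (sym (m+[n∸m]≡n (≤-trans (≤-reflexive (cong (_+ n) (e L r′ p))) large)))
          where
            e : ∀ L r p → r * (p * L) ≡ L * (r * p)
            e = solve-∀
        Ln≡ : L * n ≡ p * L + (r′ * (p * L) + n + X) + o * L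
        Ln≡ = trans (cong (L *_) (sym n≡)) (trans (e L p q o) (cong (λ x → p * L + x + o * L) Lq≡))
          where
            e : ∀ L p q o → L * (p + q + o) ≡ p * L + q * L + o * L
            e = solve-∀
        bound : M′ ^ (L * n) * b ^ n * K ^ (L * n) ≤ M ^ (L * n) * K ^ n * N ^ L * K ^ (L * n)
        bound = begin
          M′ ^ (L * n) * b ^ n * K ^ (L * n)
            ≤⟨ exponent-bound (p * L) (o * L) X n Ln≡ ⟩
          M ^ (L * n) * (a ^ (p * L) * b ^ (r′ * (p * L) + n + X) * K ^ (o * L)) * K ^ n
            ≡⟨ cong (λ x → M ^ (L * n) * (a ^ (p * L) * b ^ x * K ^ (o * L)) * K ^ n) Lq≡ ⟨
          M ^ (L * n) * (a ^ (p * L) * b ^ (q * L) * K ^ (o * L)) * K ^ n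
            ≡⟨ cong (λ x → M ^ (L * n) * x * K ^ n) power ⟩
          M ^ (L * n) * (a ^ p * b ^ q * K ^ o) ^ L * K ^ n
            ≤⟨ *-monoˡ-≤ (K ^ n) (*-monoʳ-≤ (M ^ (L * n)) (^-monoˡ-≤ L value≤)) ⟩
          M ^ (L * n) * (K ^ n * N) ^ L * K ^ n
            ≡⟨ cong (λ x → M ^ (L * n) * x * K ^ n) (trans (^-distribʳ-* (K ^ n) N L)
                 (cong (_* N ^ L) (trans (^-*-assoc K n L) (cong (K ^_) (*-comm n L))))) ⟩
          M ^ (L * n) * (K ^ (L * n) * N ^ L) * K ^ n
            ≡⟨ e (M ^ (L * n)) (K ^ (L * n)) (N ^ L) (K ^ n) ⟩
          M ^ (L * n) * K ^ n * N ^ L * K ^ (L * n) ∎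
          where
            e : ∀ x y z w → x * (y * z) * w ≡ x * w * z * y
            e = solve-∀
            power : a ^ (p * L) * b ^ (q * L) * K ^ (o * L) ≡ (a ^ p * b ^ q * K ^ o) ^ L
            power = sym (trans (^-distribʳ-* (a ^ p * b ^ q) (K ^ o) L) (cong₂ _*_
              (trans (^-distribʳ-* (a ^ p) (b ^ q) L) (cong₂ _*_ (^-*-assoc a p L) (^-*-assoc b q L)))
              (^-*-assoc K o L)))

    suc-pred-Q : suc (pred Q) ≡ Q
    suc-pred-Q = suc-pred Q {{m*n≢0 (M ^ L) K {{m^n≢0 M L}}}}

  -- The number of hits is at least |S|/r - n/(L r), without denominators. The condition is
  -- one-sided because only a class too sparse in `S` can harm the argument.
  Balanced : ∀ {r n} → ℕ → Vec (Fin r) n → Subset n → Set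
  Balanced {r} {n} L χ S = ∀ j → L * card S ≤ L * r * hits j χ S + n

  balanced-colouring : ∀ r′ L D → ∃[ n₀ ] (∀ n → n ≥ n₀ → ∀ (𝓛 : List (Subset n)) → List.length 𝓛 ≤ suc n ^ D →
    Σ[ χ ∈ Vec (Fin (suc r′)) n ] (∀ {S} → S ∈ 𝓛 → Balanced L χ S))
  balanced-colouring r′ L D = proj₁ threshold , λ n n≥n₀ 𝓛 small →
    proj₁ (balanced-value 𝓛) , λ {S} S∈𝓛 j →
      balanced n n≥n₀ 𝓛 small (proj₁ (balanced-value 𝓛)) S j (proj₂ (balanced-value 𝓛) S∈𝓛 j)
    where
      open Parameters r′ L hiding (K)
      open Potential r′ a
      -- The potential starts at the number of items, at most `suc r′ * suc n ^ D`; the `L`-th power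
      -- of this is the polynomial to be beaten.
      threshold = exponential-beats-polynomial (pred Q) (suc r′ ^ L) (D * L)
      balanced : ∀ n → n ≥ proj₁ threshold → (𝓛 : List (Subset n)) → List.length 𝓛 ≤ suc n ^ D →
        (χ : Vec (Fin (suc r′)) n) → ∀ S j → value j χ S ≤ K ^ n * (List.length 𝓛 * suc r′) →
        L * card S ≤ L * suc r′ * hits j χ S + n
      balanced n n≥n₀ 𝓛 small χ S j value≤ = ≮⇒≥ λ violated → <⇒≱ poly<exp
        (large-discrepancy (hits j χ S) (misses j χ S) (off S) n (suc r′ * suc n ^ D)
          (trans (cong (_+ off S) (hits+misses j χ S)) (card+off S))
          (≤-trans (≤-reflexive (sym (value-power j χ S))) (≤-trans value≤
            (*-monoʳ-≤ (K ^ n) (≤-trans (*-monoˡ-≤ (suc r′) small) (≤-reflexive (*-comm (suc n ^ D) (suc r′)))))))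
          (+-cancelˡ-≤ (L * hits j χ S) _ _ (begin
            L * hits j χ S + (L * (r′ * hits j χ S) + n)   ≡⟨ e₁ L r′ (hits j χ S) n ⟩
            L * suc r′ * hits j χ S + n                     ≤⟨ <⇒≤ violated ⟩
            L * card S                                      ≡⟨ cong (L *_) (hits+misses j χ S) ⟨
            L * (hits j χ S + misses j χ S)                 ≡⟨ *-distribˡ-+ L _ _ ⟩
            L * hits j χ S + L * misses j χ S               ∎)))
        where
          open ≤-Reasoning
          e₁ : ∀ L r h n → L * h + (L * (r * h) + n) ≡ L * suc r * h + n
          e₁ = solve-∀
          poly<exp : Q ^ n * (suc r′ * suc n ^ D) ^ L < suc Q ^ n
          poly<exp = subst₂ (λ q x → q ^ n * x < suc q ^ n) suc-pred-Q
            (sym (trans (^-distribʳ-* (suc r′) (suc n ^ D) L) (cong (suc r′ ^ L *_) (^-*-assoc (suc n) D L))))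
            (proj₂ threshold n n≥n₀)

  -- Double counting of the cover against the deleted points

  card-sum : ∀ {n} (S : Subset n) → card S ≡ sum (λ i → if lookup S i then 1 else 0)
  card-sum [] = refl
  card-sum (true ∷ S) = cong suc (card-sum S)
  card-sum (false ∷ S) = card-sum S

  hits-sum : ∀ {r n} j (χ : Vec (Fin r) n) S →
    hits j χ S ≡ sum (λ i → if lookup S i ∧ does (lookup χ i Fin.≟ j) then 1 else 0)
  hits-sum j [] [] = refl
  hits-sum j (c ∷ χ) (β ∷ S) = cong ((if β ∧ does (c Fin.≟ j) then 1 else 0) +_) (hits-sum j χ S)

  sum-diagonal : ∀ {r} (β : Fin r → Bool) k →
    sum (λ c → if β c ∧ does (k Fin.≟ c) then 1 else 0) ≡ (if β k then 1 else 0)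
  sum-diagonal {suc r} β zero = trans
    (cong₂ _+_ (cong (if_then 1 else 0) (∧-identityʳ (β zero)))
      (trans (sum-cong-≗ (λ c → cong (if_then 1 else 0) (∧-zeroʳ (β (suc c))))) (trans (sum-const r 0) (*-zeroʳ r))))
    (+-identityʳ _)
  sum-diagonal {suc r} β (suc k) = trans
    (cong (_+ sum (λ c → if β (suc c) ∧ does (k Fin.≟ c) then 1 else 0)) (cong (if_then 1 else 0) (∧-zeroʳ (β zero))))
    (sum-diagonal (β ∘ suc) k)

  covering-count : ∀ {r n} (S : Fin r → Subset n) → (∀ i → ∃[ c ] lookup (S c) i ≡ true) → n ≤ sum (λ c → card (S c))
  covering-count {r} {n} S cover = begin
    n                                                             ≡⟨ *-identityʳ n ⟨
    n * 1                                                         ≡⟨ sum-const n 1 ⟨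
    sum {n} (λ _ → 1)                                             ≤⟨ sum-mono (λ i → covered i (cover i)) ⟩
    sum (λ i → sum (λ c → if lookup (S c) i then 1 else 0))       ≡⟨ ∑-comm (λ i c → if lookup (S c) i then 1 else 0) ⟩
    sum (λ c → sum (λ i → if lookup (S c) i then 1 else 0))       ≡⟨ sum-cong-≗ (λ c → card-sum (S c)) ⟨
    sum (λ c → card (S c))                                        ∎
    where
      open ≤-Reasoning
      covered : ∀ i → ∃[ c ] lookup (S c) i ≡ true → 1 ≤ sum (λ c → if lookup (S c) i then 1 else 0)
      covered i (c , e) = ≤-trans (≤-reflexive (cong (if_then 1 else 0) (sym e)))
        (term≤sum (λ c → if lookup (S c) i then 1 else 0) c)

  hitting-count : ∀ {r n} (χ : Vec (Fin r) n) (S : Fin r → Subset n) Y →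
    (∀ i → lookup Y i ≡ false → lookup (S (lookup χ i)) i ≡ false) → sum (λ c → hits c χ (S c)) ≤ card Y
  hitting-count χ S Y avoid = begin
    sum (λ c → hits c χ (S c))
      ≡⟨ sum-cong-≗ (λ c → hits-sum c χ (S c)) ⟩
    sum (λ c → sum (λ i → if lookup (S c) i ∧ does (lookup χ i Fin.≟ c) then 1 else 0))
      ≡⟨ ∑-comm (λ c i → if lookup (S c) i ∧ does (lookup χ i Fin.≟ c) then 1 else 0) ⟩
    sum (λ i → sum (λ c → if lookup (S c) i ∧ does (lookup χ i Fin.≟ c) then 1 else 0))
      ≡⟨ sum-cong-≗ (λ i → sum-diagonal (λ c → lookup (S c) i) (lookup χ i)) ⟩
    sum (λ i → if lookup (S (lookup χ i)) i then 1 else 0)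
      ≤⟨ sum-mono (λ i → pointwise (lookup Y i) _ (avoid i)) ⟩
    sum (λ i → if lookup Y i then 1 else 0)
      ≡⟨ card-sum Y ⟨
    card Y ∎
    where
      open ≤-Reasoning
      pointwise : ∀ y s → (y ≡ false → s ≡ false) → (if s then 1 else 0) ≤ (if y then 1 else 0)
      pointwise true true _ = ≤-refl
      pointwise true false _ = z≤n
      pointwise false s h rewrite h refl = z≤n

  -- Balance of `S c` is applied in its own colour `c`, and the `r` errors of `n` add up to `r * n`.
  balanced-count : ∀ {r n} L (χ : Vec (Fin r) n) (S : Fin r → Subset n) Y → (∀ c → Balanced L χ (S c)) →
    (∀ i → ∃[ c ] lookup (S c) i ≡ true) → (∀ i → lookup Y i ≡ false → lookup (S (lookup χ i)) i ≡ false) →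
    L * n ≤ L * r * card Y + r * n
  balanced-count {r} {n} L χ S Y balanced cover avoid = begin
    L * n                                        ≤⟨ *-monoʳ-≤ L (covering-count S cover) ⟩
    L * sum (λ c → card (S c))                   ≡⟨ *-distribˡ-sum L (λ c → card (S c)) ⟩
    sum (λ c → L * card (S c))                   ≤⟨ sum-mono (λ c → balanced c c) ⟩
    sum (λ c → L * r * hits c χ (S c) + n)       ≡⟨ ∑-distrib-+ (λ c → L * r * hits c χ (S c)) (λ _ → n) ⟩
    sum (λ c → L * r * hits c χ (S c)) + sum {r} (λ _ → n)
      ≡⟨ cong₂ _+_ (sym (*-distribˡ-sum (L * r) (λ c → hits c χ (S c)))) (sum-const r n) ⟩
    L * r * sum (λ c → hits c χ (S c)) + r * n   ≤⟨ +-monoˡ-≤ (r * n) (*-monoʳ-≤ (L * r) (hitting-count χ S Y avoid)) ⟩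
    L * r * card Y + r * n                       ∎
    where open ≤-Reasoning

-- Sarkaria's tensor trick and tolerant colourings

module Sarkaria (R : CommutativeRing 0ℓ 0ℓ) (P : PositiveCone R) where
  open CommutativeRing R hiding (zero)
  open OrderedRing R P
  open IntegerSolver R
  open Colouring using (Balanced; balanced-colouring; balanced-count)
  open import Relation.Binary.Reasoning.Setoid setoid

  sum-↑ : ∀ m {n} (f : Vector Carrier (m ℕ.+ n)) → sum f ≈ sum (λ i → f (i ↑ˡ n)) + sum (λ i → f (m ↑ʳ i))
  sum-↑ zero f = sym (+-identityˡ _)
  sum-↑ (suc m) f = trans (+-congˡ (sum-↑ m (λ i → f (suc i)))) (sym (+-assoc _ _ _))

  sum-combine : ∀ m {n} (f : Vector Carrier (m ℕ.* n)) → sum f ≈ sum {m} (λ i → sum {n} (λ j → f (combine i j)))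
  sum-combine zero f = refl
  sum-combine (suc m) {n} f = trans (sum-↑ n f) (+-congˡ (sum-combine m (λ i → f (n ↑ʳ i))))

  indicator : ∀ {r} → Fin r → Fin r → Carrier
  indicator c j = if does (c Fin.≟ j) then 1# else 0#

  indicator-nonNeg : ∀ {r} (c j : Fin r) → NonNeg (indicator c j)
  indicator-nonNeg c j with does (c Fin.≟ j)
  ... | true = inj₁ pos-1
  ... | false = inj₂ refl

  indicator-≢ : ∀ {r} {c j : Fin r} → c ≢ j → indicator c j ≈ 0#
  indicator-≢ {c = c} {j} c≢j with c Fin.≟ j
  ... | yes c≡j = ⊥-elim (c≢j c≡j)
  ... | no _ = refl

  sum-indicator : ∀ {r} (c : Fin r) (f : Vector Carrier r) → sum (λ j → indicator c j * f j) ≈ f c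
  sum-indicator zero f =
    trans (+-cong (*-identityˡ _) (sum-zero (λ j → zeroˡ (f (suc j))))) (+-identityʳ _)
  sum-indicator (suc c) f =
    trans (+-cong (zeroˡ _) (sum-indicator c (λ j → f (suc j)))) (+-identityˡ _)

  module _ {r′ n E} (χ : Fin n → Fin (suc r′)) (x : Fin n → Vector Carrier E) where

    sign : Fin (suc r′) → Fin r′ → Carrier
    sign c j = indicator c (suc j) - indicator c zero

    -- Sarkaria's tensor trick: the vectors v_c = (sign c j)_j sum to zero and satisfy no other
    -- linear relation, and the point of index i is replaced by its tensor product with v_{χ i}.
    tensor : Fin n → Vector Carrier (r′ ℕ.* E)
    tensor i l = sign (χ i) (proj₁ (remQuot {r′} E l)) * x i (proj₂ (remQuot {r′} E l))

    tensor-combine : ∀ i j k → tensor i (combine j k) ≡ sign (χ i) j * x i k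
    tensor-combine i j k = ≡.cong (λ jk → sign (χ i) (proj₁ jk) * x i (proj₂ jk)) (remQuot-combine {r′} j k)

    -- The contraction of `u` with `sign c` in the first tensor factor. All entries of `sign zero`
    -- are -1, which gives minus the sum of the other functionals.
    functionals : Vector Carrier (r′ ℕ.* E) → Fin (suc r′) → Vector Carrier E
    functionals u (suc j) k = u (combine j k)
    functionals u zero k = - sum (λ j → u (combine {r′} j k))

    functionals-zero : ∀ u y → functionals u zero · y ≈ - sum (λ j → functionals u (suc j) · y)
    functionals-zero u y = begin
      sum (λ k → - sum (λ j → u (combine {r′} j k)) * y k)
        ≈⟨ sum-cong-≋ (λ k → trans (solve 2 (λ a b → (:- a) :* b := :- (a :* b)) refl _ (y k))
                                   (-‿cong (*-distribʳ-sum (y k) (λ j → u (combine {r′} j k))))) ⟩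
      sum (λ k → - sum (λ j → u (combine {r′} j k) * y k))
        ≈⟨ sum-neg (λ k → sum (λ j → u (combine {r′} j k) * y k)) ⟩
      - sum (λ k → sum (λ j → u (combine {r′} j k) * y k))
        ≈⟨ -‿cong (∑-comm (λ k j → u (combine {r′} j k) * y k)) ⟩
      - sum (λ j → functionals u (suc j) · y) ∎

    sum-functionals : ∀ u y → sum (λ c → functionals u c · y) ≈ 0#
    sum-functionals u y = trans (+-congʳ (functionals-zero u y)) (-‿inverseˡ _)

    sum-sign : ∀ u c y → sum (λ j → sign c j * (functionals u (suc j) · y)) ≈ functionals u c · y
    sum-sign u zero y = begin
      sum (λ j → (0# - 1#) * (functionals u (suc j) · y))
        ≈⟨ sum-cong-≋ (λ j → trans (*-congʳ (+-identityˡ _))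
             (trans (solve 2 (λ a b → (:- a) :* b := :- (a :* b)) refl 1# (functionals u (suc j) · y))
                    (-‿cong (*-identityˡ _)))) ⟩
      sum (λ j → - (functionals u (suc j) · y))
        ≈⟨ sum-neg (λ j → functionals u (suc j) · y) ⟩
      - sum (λ j → functionals u (suc j) · y)
        ≈⟨ functionals-zero u y ⟨
      functionals u zero · y ∎
    sum-sign u (suc c) y = begin
      sum (λ j → (indicator c j - 0#) * (functionals u (suc j) · y))
        ≈⟨ sum-cong-≋ (λ j → *-congʳ (solve 1 (λ a → a :- con (ℤ.+ 0) := a) refl (indicator c j))) ⟩
      sum (λ j → indicator c j * (functionals u (suc j) · y))
        ≈⟨ sum-indicator c (λ j → functionals u (suc j) · y) ⟩
      functionals u (suc c) · y ∎

    -- This is how a separator of the tensors becomes a family of functionals, one per class, each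
    -- negative on the active points of its own class.
    ·-tensor : ∀ u i → u · tensor i ≈ functionals u (χ i) · x i
    ·-tensor u i = begin
      u · tensor i
        ≈⟨ sum-combine r′ (λ l → u l * tensor i l) ⟩
      sum {r′} (λ j → sum (λ k → u (combine j k) * tensor i (combine j k)))
        ≈⟨ sum-cong-≋ {r′} (λ j → sum-cong-≋ (λ k → trans (*-congˡ (reflexive (tensor-combine i j k)))
             (solve 3 (λ u s x → u :* (s :* x) := s :* (u :* x)) refl (u (combine j k)) (sign (χ i) j) (x i k)))) ⟩
      sum {r′} (λ j → sum (λ k → sign (χ i) j * (u (combine j k) * x i k)))
        ≈⟨ sum-cong-≋ {r′} (λ j → *-distribˡ-sum (sign (χ i) j) (λ k → u (combine j k) * x i k)) ⟨
      sum {r′} (λ j → sign (χ i) j * (functionals u (suc j) · x i))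
        ≈⟨ sum-sign u (χ i) (x i) ⟩
      functionals u (χ i) · x i ∎

    block : Vector Carrier n → Fin (suc r′) → Vector Carrier n
    block w c i = w i * indicator (χ i) c

    -- Since `sign c j` is a difference of two indicators, coordinate `combine j k` of the null
    -- relation says that the blocks `suc j` and `zero` have equal sums in coordinate `k`.
    block-balanced : ∀ w → (∀ l → sum (λ i → w i * tensor i l) ≈ 0#) →
      ∀ c k → sum (λ i → block w c i * x i k) ≈ sum (λ i → block w zero i * x i k)
    block-balanced w null zero k = refl
    block-balanced w null (suc j) k = begin
      T (suc j)
        ≈⟨ solve 2 (λ a b → a := (a :+ :- b) :+ b) refl (T (suc j)) (T zero) ⟩
      (T (suc j) - T zero) + T zero
        ≈⟨ +-congʳ (+-congˡ (sum-neg (λ i → block w zero i * x i k))) ⟨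
      (T (suc j) + sum (λ i → - (block w zero i * x i k))) + T zero
        ≈⟨ +-congʳ (∑-distrib-+ (λ i → block w (suc j) i * x i k) (λ i → - (block w zero i * x i k))) ⟨
      sum (λ i → block w (suc j) i * x i k - block w zero i * x i k) + T zero
        ≈⟨ +-congʳ (sum-cong-≋ (λ i → trans
             (solve 4 (λ w a b x → w :* a :* x :- w :* b :* x := w :* ((a :- b) :* x))
                refl (w i) (indicator (χ i) (suc j)) (indicator (χ i) zero) (x i k))
             (*-congˡ (reflexive (≡.sym (tensor-combine i j k)))))) ⟩
      sum (λ i → w i * tensor i (combine j k)) + T zero
        ≈⟨ trans (+-congʳ (null (combine j k))) (+-identityˡ _) ⟩
      T zero ∎
      where
        T : Fin (suc r′) → Carrier
        T c = sum (λ i → block w c i * x i k)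

    sum-block : ∀ w → sum (λ c → sum (block w c)) ≈ sum w
    sum-block w = begin
      sum (λ c → sum (λ i → w i * indicator (χ i) c))
        ≈⟨ ∑-comm (λ c i → w i * indicator (χ i) c) ⟩
      sum (λ i → sum (λ c → w i * indicator (χ i) c))
        ≈⟨ sum-cong-≋ (λ i → sum-cong-≋ (λ c → *-comm (w i) (indicator (χ i) c))) ⟩
      sum (λ i → sum (λ c → indicator (χ i) c * w i))
        ≈⟨ sum-cong-≋ (λ i → sum-indicator (χ i) (λ _ → w i)) ⟩
      sum w ∎

  homogenise : ∀ {d} → Vector Carrier d → Vector Carrier (suc d)
  homogenise x zero = 1#
  homogenise x (suc k) = x k

  record CommonPoint {r n d} (χ : Fin n → Fin r) (x : Fin n → Vector Carrier d) (B : Subset n) : Set where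
    field
      centre    : Vector Carrier d
      weight    : Fin r → Vector Carrier n
      nonNeg    : ∀ c i → NonNeg (weight c i)
      inactive  : ∀ c i → lookup B i ≡ outside → weight c i ≈ 0#
      foreign   : ∀ c i → χ i ≢ c → weight c i ≈ 0#
      total     : ∀ c → sum (weight c) ≈ 1#
      combined  : ∀ c k → centre k ≈ sum (λ i → weight c i * x i k)

  -- The homogenising coordinate gives all classes the same total weight `W`, and the other
  -- coordinates give them the same weighted sum. If `W` were zero, the total weight would vanish;
  -- so dividing by `W` normalises all classes at once.
  dependent⇒commonPoint : (∀ a → Pos a → ∃[ b ] a * b ≈ 1#) →
    ∀ {r′ n d} (χ : Fin n → Fin (suc r′)) (x : Fin n → Vector Carrier d) B →
    Dependent (tensor χ (λ i → homogenise (x i))) B → CommonPoint χ x B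
  dependent⇒commonPoint inverse {r′} {n} χ x B dep = record
    { centre = λ k → V * T zero (suc k)
    ; weight = λ c i → V * ω c i
    ; nonNeg = λ c i → nonNeg*nonNeg (inj₁ V>0) (ω≥0 c i)
    ; inactive = λ c i i∉B → trans (*-congˡ (trans (*-congʳ (supported i i∉B)) (zeroˡ _))) (zeroʳ V)
    ; foreign = λ c i χi≢c → trans (*-congˡ (trans (*-congˡ (indicator-≢ χi≢c)) (zeroʳ _))) (zeroʳ V)
    ; total = λ c → trans (sym (*-distribˡ-sum V (ω c))) (trans (*-congˡ (total-ω c)) (trans (*-comm V W) WV≈1))
    ; combined = λ c k → trans (*-congˡ (sym (balanced c (suc k))))
        (trans (*-distribˡ-sum V (λ i → ω c i * x i k)) (sum-cong-≋ (λ i → sym (*-assoc V (ω c i) (x i k)))))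
    }
    where
      open Dependent dep renaming (weight to w; nonNeg to w≥0)
      x̂ : Fin n → Vector Carrier _
      x̂ i = homogenise (x i)
      ω : Fin (suc r′) → Vector Carrier n
      ω = block χ x̂ w
      T : Fin (suc r′) → Vector Carrier _
      T c k = sum (λ i → ω c i * x̂ i k)
      balanced : ∀ c k → T c k ≈ T zero k
      balanced = block-balanced χ x̂ w null
      ω≥0 : ∀ c i → NonNeg (ω c i)
      ω≥0 c i = nonNeg*nonNeg (w≥0 i) (indicator-nonNeg (χ i) c)
      W = T zero zero
      total-ω : ∀ c → sum (ω c) ≈ W
      total-ω c = trans (sum-cong-≋ (λ i → sym (*-identityʳ (ω c i)))) (balanced c zero)
      W>0 : Pos W
      W>0 with nonNeg-resp (total-ω zero) (sum-nonNeg (ω≥0 zero))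
      ... | inj₁ p = p
      ... | inj₂ W≈0 = ⊥-elim (0-not-pos (pos-resp
              (trans (sym (sum-block χ x̂ w)) (sum-zero (λ c → trans (total-ω c) W≈0))) total))
      V = proj₁ (inverse W W>0)
      WV≈1 = proj₂ (inverse W W>0)
      V>0 : Pos V
      V>0 = pos-cancelˡ W>0 (pos-resp (sym WV≈1) pos-1)

  nonNeg-term⊎all-neg : ∀ {r} (f : Vector Carrier r) → (∃[ c ] NonNeg (f c)) ⊎ (∀ c → Neg (f c))
  nonNeg-term⊎all-neg {zero} f = inj₂ λ ()
  nonNeg-term⊎all-neg {suc r} f with nonNeg⊎neg (f zero) | nonNeg-term⊎all-neg (λ c → f (suc c))
  ... | inj₁ p | _ = inj₁ (zero , p)
  ... | inj₂ _ | inj₁ (c , p) = inj₁ (suc c , p)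
  ... | inj₂ n | inj₂ ns = inj₂ λ { zero → n ; (suc c) → ns c }

  sum≈0⇒nonNeg-term : ∀ {r} (f : Vector Carrier (suc r)) → sum f ≈ 0# → ∃[ c ] NonNeg (f c)
  sum≈0⇒nonNeg-term f Σf≈0 with nonNeg-term⊎all-neg f
  ... | inj₁ found = found
  ... | inj₂ neg = ⊥-elim (neg⇒¬nonNeg
          (pos-resp (sum-neg f) (sum-pos {f = λ c → - f c} (λ c → inj₁ (neg c)) zero (neg zero))) (inj₂ Σf≈0))

  hasSign-nonNeg : ∀ β {x} → HasSign β x → NonNeg x → β ≡ true
  hasSign-nonNeg true _ _ = ≡.refl
  hasSign-nonNeg false n p = ⊥-elim (neg⇒¬nonNeg n p)

  hasSign-neg : ∀ β {x} → HasSign β x → Neg x → β ≡ false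
  hasSign-neg true p n = ⊥-elim (neg⇒¬nonNeg n p)
  hasSign-neg false _ _ = ≡.refl

  -- The colouring depends on the points alone, through the list of all their half-space sections.
  -- Whatever `Y` comes later, the functionals that separate after its deletion have their sections
  -- in that list.
  tolerant-colouring : ExcludedMiddle 0ℓ → (∀ a → Pos a → ∃[ b ] a * b ≈ 1#) → ∀ r′ d L →
    ∃[ n₀ ] (∀ n → n ℕ.≥ n₀ → ∀ (x : Fin n → Vector Carrier d) →
      Σ[ χ ∈ Vec (Fin (suc r′)) n ] (∀ Y →
        L ℕ.* suc r′ ℕ.* card Y ℕ.+ suc r′ ℕ.* n ℕ.< L ℕ.* n → CommonPoint (lookup χ) x (∁ Y)))
  tolerant-colouring em inverse r′ d L = proj₁ threshold , λ n n≥n₀ x →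
    let 𝓛 , small , complete = patterns em n (suc d) (λ i → homogenise (x i))
        χ , balanced = proj₂ threshold n n≥n₀ 𝓛 small
    in χ , λ Y few → tolerate x χ Y (λ u S h → balanced (complete u S h)) few
      (gordan (tensor (lookup χ) (λ i → homogenise (x i))) (∁ Y))
    where
      threshold = balanced-colouring r′ L (suc d)
      tolerate : ∀ {n} (x : Fin n → Vector Carrier d) (χ : Vec (Fin (suc r′)) n) Y →
        (∀ u S → HasPattern (λ i → homogenise (x i)) u S → Balanced L χ S) →
        L ℕ.* suc r′ ℕ.* card Y ℕ.+ suc r′ ℕ.* n ℕ.< L ℕ.* n →
        Separated (tensor (lookup χ) (λ i → homogenise (x i))) (∁ Y) ⊎
        Dependent (tensor (lookup χ) (λ i → homogenise (x i))) (∁ Y) → CommonPoint (lookup χ) x (∁ Y)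
      tolerate x χ Y balanced few (inj₂ dep) = dependent⇒commonPoint inverse (lookup χ) x (∁ Y) dep
      tolerate {n} x χ Y balanced few (inj₁ (u , sep)) =
        ⊥-elim (ℕ.<⇒≱ few (balanced-count L χ S Y (λ c → balanced (U c) (S c) (S-pattern c)) cover avoid))
        where
          x̂ : Fin n → Vector Carrier (suc d)
          x̂ i = homogenise (x i)
          U : Fin (suc r′) → Vector Carrier (suc d)
          U = functionals (lookup χ) x̂ u
          S : Fin (suc r′) → Subset n
          S c = proj₁ (pattern-of x̂ (U c))
          S-pattern : ∀ c → HasPattern x̂ (U c) (S c)
          S-pattern c = proj₂ (pattern-of x̂ (U c))
          cover : ∀ i → ∃[ c ] lookup (S c) i ≡ true
          cover i =
            let c , p = sum≈0⇒nonNeg-term (λ c → U c · x̂ i) (sum-functionals (lookup χ) x̂ u (x̂ i))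
            in c , hasSign-nonNeg (lookup (S c) i) (S-pattern c i) p
          avoid : ∀ i → lookup Y i ≡ false → lookup (S (lookup χ i)) i ≡ false
          avoid i i∉Y = hasSign-neg (lookup (S (lookup χ i)) i) (S-pattern (lookup χ i) i)
            (neg-resp (·-tensor (lookup χ) x̂ u i) (sep i (≡.trans (lookup-map i not Y) (≡.cong not i∉Y))))

-- The ordered field of real numbers

module RealNumbers where
  open import Data.Rational
  open import Data.Rational.Properties
  open import Relation.Binary.Structures using (IsEquivalence)
  open ≡ using (refl; sym; trans; cong; cong₂; subst; subst₂)
  open IntegerSolver +-*-commutativeRing using (solve; _:+_; _:*_; _:-_; :-_; _:=_)

  eventually-map₂ : ∀ {P Q R : ℕ → Set} → (∀ n → P n → Q n → R n) → Eventually P → Eventually Q → Eventually R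
  eventually-map₂ f (M , p) (N , q) = M ℕ.⊔ N , λ n ≤n →
    f n (p n (ℕ.m⊔n≤o⇒m≤o M N ≤n)) (q n (ℕ.m⊔n≤o⇒n≤o M N ≤n))

  eventually-map : ∀ {P Q : ℕ → Set} → (∀ n → P n → Q n) → Eventually P → Eventually Q
  eventually-map f (N , p) = N , λ n ≤n → f n (p n ≤n)

  pos+ : ∀ {p q} → 0ℚ < p → 0ℚ < q → 0ℚ < p + q
  pos+ 0<p 0<q = +-mono-< 0<p 0<q

  pos* : ∀ {p q} → 0ℚ < p → 0ℚ < q → 0ℚ < p * q
  pos* {p} {q} 0<p 0<q = positive⁻¹ (p * q) {{pos*pos⇒pos p {{positive 0<p}} q {{positive 0<q}}}}

  reciprocal : ∀ {p} → 0ℚ < p → Σ[ q ∈ ℚ ] 0ℚ < q × p * q ≡ 1ℚ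
  reciprocal {p} 0<p = 1/ p , positive⁻¹ (1/ p) {{1/pos⇒pos p}} , *-inverseʳ p
    where instance
      p⁺ : Positive p
      p⁺ = positive 0<p
      p≢0 : NonZero p
      p≢0 = pos⇒nonZero p

  rescale : ∀ {C} → 0ℚ < C → ∀ {ε} → 0ℚ < ε → Σ[ η ∈ ℚ ] 0ℚ < η × C * η ≡ ε
  rescale {C} 0<C {ε} 0<ε with reciprocal 0<C
  ... | D , 0<D , CD≡1 = D * ε , pos* 0<D 0<ε ,
    trans (sym (*-assoc C D ε)) (trans (cong (_* ε) CD≡1) (*-identityˡ ε))

  0<1 : 0ℚ < 1ℚ
  0<1 = positive⁻¹ 1ℚ

  halve : ∀ {ε} → 0ℚ < ε → Σ[ η ∈ ℚ ] 0ℚ < η × η + η ≡ ε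
  halve {ε} 0<ε = ½ * ε , pos* (positive⁻¹ ½) 0<ε , trans (sym (*-distribʳ-+ ε ½ ½)) (*-identityˡ ε)

  p≤∣p∣ : ∀ p → p ≤ ∣ p ∣
  p≤∣p∣ p with ≤-total 0ℚ p
  ... | inj₁ 0≤p = ≤-reflexive (sym (0≤p⇒∣p∣≡p 0≤p))
  ... | inj₂ p≤0 = ≤-trans p≤0 (0≤∣p∣ p)

  lower-bound : ∀ {p q δ η} → η + η ≡ δ → δ ≤ p → ∣ p - q ∣ < η → η < q
  lower-bound {p} {q} {δ} {η} 2η≡δ δ≤p close = begin-strict
    η                      ≡⟨ solve 1 (λ η → η := η :+ η :- η) refl η ⟩
    η + η - η              ≡⟨ cong (_- η) 2η≡δ ⟩
    δ - η                  ≤⟨ +-monoˡ-≤ (- η) δ≤p ⟩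
    p - η                  <⟨ +-monoʳ-< p (neg-antimono-< (≤-<-trans (p≤∣p∣ (p - q)) close)) ⟩
    p - (p - q)            ≡⟨ solve 2 (λ p q → p :- (p :- q) := q) refl p q ⟩
    q                      ∎
    where open ≤-Reasoning

  ∣*∣-bound : ∀ {A p q η} → 0ℚ < A → ∣ p ∣ ≤ A → ∣ q ∣ < η → ∣ p * q ∣ < A * η
  ∣*∣-bound {A} {p} {q} {η} 0<A p≤A q<η = begin-strict
    ∣ p * q ∣      ≡⟨ ∣p*q∣≡∣p∣*∣q∣ p q ⟩
    ∣ p ∣ * ∣ q ∣  ≤⟨ *-monoʳ-≤-nonNeg ∣ q ∣ {{nonNegative (0≤∣p∣ q)}} p≤A ⟩
    A * ∣ q ∣      <⟨ *-monoʳ-<-pos A {{positive 0<A}} q<η ⟩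
    A * η          ∎
    where open ≤-Reasoning

  Null : (ℕ → ℚ) → Set
  Null a = ∀ ε → 0ℚ < ε → Eventually λ n → ∣ a n ∣ < ε

  null-resp : ∀ {a b} → (∀ n → a n ≡ b n) → Null a → Null b
  null-resp a≡b na ε 0<ε = eventually-map (λ n → subst (λ x → ∣ x ∣ < ε) (a≡b n)) (na ε 0<ε)

  null-0 : Null (λ _ → 0ℚ)
  null-0 ε 0<ε = 0 , λ _ _ → 0<ε

  null-neg : ∀ {a} → Null a → Null (λ n → - a n)
  null-neg {a} na ε 0<ε = eventually-map (λ n → subst (_< ε) (sym (∣-p∣≡∣p∣ (a n)))) (na ε 0<ε)

  null-+ : ∀ {a b} → Null a → Null b → Null (λ n → a n + b n)
  null-+ {a} {b} na nb ε 0<ε with halve 0<ε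
  ... | η , 0<η , 2η≡ε = eventually-map₂ (λ n a<η b<η → begin-strict
      ∣ a n + b n ∣        ≤⟨ ∣p+q∣≤∣p∣+∣q∣ (a n) (b n) ⟩
      ∣ a n ∣ + ∣ b n ∣    <⟨ +-mono-< a<η b<η ⟩
      η + η                ≡⟨ 2η≡ε ⟩
      ε                    ∎) (na η 0<η) (nb η 0<η)
    where open ≤-Reasoning

  cauchy⇒bounded : ∀ {a} → IsCauchy a → Σ[ A ∈ ℚ ] 0ℚ < A × Eventually λ n → ∣ a n ∣ ≤ A
  cauchy⇒bounded {a} ca with ca 1ℚ 0<1
  ... | N , close = 1ℚ + ∣ a N ∣ , +-mono-<-≤ 0<1 (0≤∣p∣ (a N)) , N , λ n N≤n → begin
      ∣ a n ∣                  ≡⟨ cong ∣_∣ (solve 2 (λ p q → p := (p :- q) :+ q) refl (a n) (a N)) ⟩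
      ∣ (a n - a N) + a N ∣    ≤⟨ ∣p+q∣≤∣p∣+∣q∣ (a n - a N) (a N) ⟩
      ∣ a n - a N ∣ + ∣ a N ∣  ≤⟨ +-monoˡ-≤ ∣ a N ∣ (<⇒≤ (close n N N≤n ℕ.≤-refl)) ⟩
      1ℚ + ∣ a N ∣             ∎
    where open ≤-Reasoning

  bounded*null : ∀ {A} {a b : ℕ → ℚ} → 0ℚ < A → Eventually (λ n → ∣ a n ∣ ≤ A) → Null b → Null (λ n → a n * b n)
  bounded*null {A} {a} {b} 0<A a≤A nb ε 0<ε =
    let η , 0<η , Aη≡ε = rescale 0<A 0<ε in
    eventually-map₂ {λ n → ∣ a n ∣ ≤ A} {λ n → ∣ b n ∣ < η} {λ n → ∣ a n * b n ∣ < ε}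
      (λ n a≤ b< → subst (∣ a n * b n ∣ <_) Aη≡ε (∣*∣-bound {A} {a n} {b n} {η} 0<A a≤ b<)) a≤A (nb η 0<η)

  cauchy*null : ∀ {a b} → IsCauchy a → Null b → Null (λ n → a n * b n)
  cauchy*null {a} {b} ca nb =
    let A , 0<A , a≤A = cauchy⇒bounded {a} ca in bounded*null {A} {a} {b} 0<A a≤A nb

  ≡⇒≈ᴿ : ∀ {x y} → (∀ n → seq x n ≡ seq y n) → x ≈ᴿ y
  ≡⇒≈ᴿ {x} {y} x≡y = null-resp (λ n → sym (trans (cong (_- seq y n) (x≡y n)) (+-inverseʳ (seq y n)))) null-0

  -- Wrapping _≈ᴿ_ in a record lets its arguments be inferred.
  infix 4 _≅_
  record _≅_ (x y : ℝ) : Set where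
    constructor mk≅
    field un≅ : x ≈ᴿ y
  open _≅_

  ℝ-commutativeRing : CommutativeRing 0ℓ 0ℓ
  ℝ-commutativeRing = record
    { Carrier = ℝ ; _≈_ = _≅_ ; _+_ = _+ᴿ_ ; _*_ = _*ᴿ_ ; -_ = -ᴿ_ ; 0# = 0ᴿ ; 1# = 1ᴿ
    ; isCommutativeRing = record
      { isRing = record
        { +-isAbelianGroup = record
          { isGroup = record
            { isMonoid = record
              { isSemigroup = record
                { isMagma = record { isEquivalence = ≅-isEquivalence ; ∙-cong = λ {x} {y} {u} {v} → +-cong′ x y u v }
                ; assoc = λ x y z → pointwise λ n → +-assoc (seq x n) (seq y n) (seq z n) }
              ; identity = (λ x → pointwise λ n → +-identityˡ (seq x n)) , (λ x → pointwise λ n → +-identityʳ (seq x n)) }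
            ; inverse = (λ x → pointwise λ n → +-inverseˡ (seq x n)) , (λ x → pointwise λ n → +-inverseʳ (seq x n))
            ; ⁻¹-cong = λ {x} {y} → neg-cong′ x y }
          ; comm = λ x y → pointwise λ n → +-comm (seq x n) (seq y n) }
        ; *-cong = λ {x} {y} {u} {v} → *-cong′ x y u v
        ; *-assoc = λ x y z → pointwise λ n → *-assoc (seq x n) (seq y n) (seq z n)
        ; *-identity = (λ x → pointwise λ n → *-identityˡ (seq x n)) , (λ x → pointwise λ n → *-identityʳ (seq x n))
        ; distrib = (λ x y z → pointwise λ n → *-distribˡ-+ (seq x n) (seq y n) (seq z n)) ,
                    (λ x y z → pointwise λ n → *-distribʳ-+ (seq x n) (seq y n) (seq z n)) }
      ; *-comm = λ x y → pointwise λ n → *-comm (seq x n) (seq y n) } }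
    where
      pointwise : ∀ {x y} → (∀ n → seq x n ≡ seq y n) → x ≅ y
      pointwise {x} {y} h = mk≅ (≡⇒≈ᴿ {x} {y} h)
      ≅-isEquivalence : IsEquivalence _≅_
      ≅-isEquivalence = record
        { refl = pointwise λ _ → refl
        ; sym = λ {x} {y} e → mk≅ (null-resp
            (λ n → solve 2 (λ x y → :- (x :- y) := y :- x) refl (seq x n) (seq y n)) (null-neg (un≅ e)))
        ; trans = λ {x} {y} {z} e f → mk≅ (null-resp
            (λ n → solve 3 (λ x y z → (x :- y) :+ (y :- z) := x :- z) refl (seq x n) (seq y n) (seq z n))
            (null-+ (un≅ e) (un≅ f))) }
      +-cong′ : ∀ x y u v → x ≅ y → u ≅ v → x +ᴿ u ≅ y +ᴿ v
      +-cong′ x y u v e f = mk≅ (null-resp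
        (λ n → solve 4 (λ x y u v → (x :- y) :+ (u :- v) := (x :+ u) :- (y :+ v)) refl (seq x n) (seq y n) (seq u n) (seq v n))
        (null-+ (un≅ e) (un≅ f)))
      neg-cong′ : ∀ x y → x ≅ y → -ᴿ x ≅ -ᴿ y
      neg-cong′ x y e = mk≅ (null-resp
        (λ n → solve 2 (λ x y → :- (x :- y) := :- x :- :- y) refl (seq x n) (seq y n)) (null-neg (un≅ e)))
      *-cong′ : ∀ x y u v → x ≅ y → u ≅ v → x *ᴿ u ≅ y *ᴿ v
      *-cong′ x y u v e f = mk≅ (null-resp
        (λ n → solve 4 (λ x y u v → x :* (u :- v) :+ v :* (x :- y) := x :* u :- y :* v) refl (seq x n) (seq y n) (seq u n) (seq v n))
        (null-+ (cauchy*null {seq x} (cauchy x) (un≅ f)) (cauchy*null {seq v} (cauchy v) (un≅ e))))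

  Positiveᴿ : ℝ → Set
  Positiveᴿ x = ∃[ δ ] 0ℚ < δ × Eventually λ n → δ < seq x n

  -- A late term of modulus at least `ε` would, by the Cauchy condition, keep its sign with margin
  -- ε/2 in all late terms. If neither sign is positive in this sense, the sequence therefore tends
  -- to zero.
  ℝ-trichotomy : ExcludedMiddle 0ℓ → ∀ x → Positiveᴿ x ⊎ x ≅ 0ᴿ ⊎ Positiveᴿ (-ᴿ x)
  ℝ-trichotomy em x with em {Positiveᴿ x} | em {Positiveᴿ (-ᴿ x)}
  ... | yes p | _ = inj₁ p
  ... | no _ | yes n = inj₂ (inj₂ n)
  ... | no ¬p | no ¬n = inj₂ (inj₁ (mk≅ (null-resp (λ n → sym (+-identityʳ (seq x n))) null)))
    where
      null : Null (seq x)
      null ε 0<ε with halve 0<ε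
      ... | η , 0<η , 2η≡ε with cauchy x η 0<η
      ...   | N , close = N , λ n N≤n → ≰⇒> λ ε≤∣xn∣ → impossible n N≤n ε≤∣xn∣ (∣p∣≡p∨∣p∣≡-p (seq x n))
        where
          impossible : ∀ n → N ℕ.≤ n → ε ≤ ∣ seq x n ∣ → ¬ (∣ seq x n ∣ ≡ seq x n ⊎ ∣ seq x n ∣ ≡ - seq x n)
          impossible n N≤n ε≤ (inj₁ e) = ¬p (η , 0<η , N , λ m N≤m →
            lower-bound 2η≡ε (subst (ε ≤_) e ε≤) (close n m N≤n N≤m))
          impossible n N≤n ε≤ (inj₂ e) = ¬n (η , 0<η , N , λ m N≤m →
            lower-bound 2η≡ε (subst (ε ≤_) e ε≤)
              (subst (_< η) (cong ∣_∣ (solve 2 (λ x y → y :- x := :- x :- :- y) refl (seq x n) (seq x m))) (close m n N≤m N≤n)))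

  ℝ-positiveCone : ExcludedMiddle 0ℓ → PositiveCone ℝ-commutativeRing
  ℝ-positiveCone em = record
    { Pos = Positiveᴿ
    ; pos-resp = λ {x} {y} → resp x y
    ; pos+pos = λ { (δ , 0<δ , p) (η , 0<η , q) → δ + η , pos+ 0<δ 0<η , eventually-map₂ (λ _ → +-mono-<) p q }
    ; pos*pos = λ {x} {y} → product x y
    ; pos-1 = ½ , positive⁻¹ ½ , 0 , λ _ _ → ½<1
    ; 0-not-pos = λ { (δ , 0<δ , N , p) → <-asym 0<δ (p N ℕ.≤-refl) }
    ; trichotomy = ℝ-trichotomy em }
    where
      ½<1 : ½ < 1ℚ
      ½<1 = subst (_< 1ℚ) (+-identityʳ ½) (+-monoʳ-< ½ (positive⁻¹ ½))
      resp : ∀ x y → x ≅ y → Positiveᴿ x → Positiveᴿ y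
      resp x y e (δ , 0<δ , p) with halve 0<δ
      ... | η , 0<η , 2η≡δ = η , 0<η , eventually-map₂ (λ n δ<x → lower-bound 2η≡δ (<⇒≤ δ<x)) p ((un≅ e) η 0<η)
      product : ∀ x y → Positiveᴿ x → Positiveᴿ y → Positiveᴿ (x *ᴿ y)
      product x y (δ , 0<δ , p) (η , 0<η , q) = δ * η , pos* 0<δ 0<η , eventually-map₂ (λ n δ<x η<y →
        <-trans (*-monoˡ-<-pos η {{positive 0<η}} δ<x)
                (*-monoʳ-<-pos (seq x n) {{positive (<-trans 0<δ δ<x)}} η<y)) p q

  ℝ-inverse : ∀ x → Positiveᴿ x → Σ[ y ∈ ℝ ] x *ᴿ y ≅ 1ᴿ
  ℝ-inverse x (δ , 0<δ , N , δ<x) = mkℝ y y-cauchy ,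
    mk≅ (λ ε 0<ε → N , λ n N≤n → subst (λ z → ∣ z - 1ℚ ∣ < ε) (sym (inverse n N≤n)) 0<ε)
    where
      -- The terms before `N` are replaced by the term at `N`, so that every term exceeds `δ` and
      -- has a reciprocal.
      x′ : ℕ → ℚ
      x′ n = seq x (N ℕ.⊔ n)
      δ<x′ : ∀ n → δ < x′ n
      δ<x′ n = δ<x (N ℕ.⊔ n) (ℕ.m≤m⊔n N n)
      recip : ∀ n → Σ[ q ∈ ℚ ] 0ℚ < q × x′ n * q ≡ 1ℚ
      recip n = reciprocal (<-trans 0<δ (δ<x′ n))
      y : ℕ → ℚ
      y n = proj₁ (recip n)
      inverse : ∀ n → N ℕ.≤ n → seq x n * y n ≡ 1ℚ
      inverse n N≤n = subst (λ m → seq x m * y n ≡ 1ℚ) (ℕ.m≤n⇒m⊔n≡n N≤n) (proj₂ (proj₂ (recip n)))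
      δ⁻¹ = reciprocal 0<δ
      Y = proj₁ δ⁻¹
      0<Y = proj₁ (proj₂ δ⁻¹)
      y≤Y : ∀ n → ∣ y n ∣ ≤ Y
      y≤Y n = begin
        ∣ y n ∣               ≡⟨ 0≤p⇒∣p∣≡p (<⇒≤ 0<y) ⟩
        y n                   ≡⟨ *-identityˡ (y n) ⟨
        1ℚ * y n              ≡⟨ cong (_* y n) (proj₂ (proj₂ δ⁻¹)) ⟨
        δ * Y * y n           ≡⟨ solve 3 (λ a b c → a :* b :* c := a :* (b :* c)) refl δ Y (y n) ⟩
        δ * (Y * y n)         ≤⟨ *-monoʳ-≤-nonNeg (Y * y n) {{nonNegative (<⇒≤ (pos* 0<Y 0<y))}} (<⇒≤ (δ<x′ n)) ⟩
        x′ n * (Y * y n)      ≡⟨ solve 3 (λ a b c → a :* (b :* c) := a :* c :* b) refl (x′ n) Y (y n) ⟩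
        x′ n * y n * Y        ≡⟨ cong (_* Y) (proj₂ (proj₂ (recip n))) ⟩
        1ℚ * Y                ≡⟨ *-identityˡ Y ⟩
        Y                     ∎
        where
          open ≤-Reasoning
          0<y = proj₁ (proj₂ (recip n))
      difference : ∀ m n → y m * (y n * (x′ n - x′ m)) ≡ y m - y n
      difference m n = begin
        y m * (y n * (x′ n - x′ m))
          ≡⟨ solve 4 (λ a b c d → a :* (b :* (d :- c)) := a :* (d :* b) :- b :* (c :* a)) refl (y m) (y n) (x′ m) (x′ n) ⟩
        y m * (x′ n * y n) - y n * (x′ m * y m)
          ≡⟨ cong₂ (λ p q → y m * p - y n * q) (proj₂ (proj₂ (recip n))) (proj₂ (proj₂ (recip m))) ⟩
        y m * 1ℚ - y n * 1ℚ
          ≡⟨ cong₂ _-_ (*-identityʳ (y m)) (*-identityʳ (y n)) ⟩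
        y m - y n ∎
        where open ≡-Reasoning
      y-cauchy : IsCauchy y
      y-cauchy ε 0<ε =
        -- By `difference` a gap in `x′` is multiplied by two reciprocals, each at most `Y`; hence
        -- `ε` is divided by `Y` twice.
        let ε′ , 0<ε′ , Yε′≡ε = rescale 0<Y 0<ε
            η , 0<η , Yη≡ε′ = rescale 0<Y 0<ε′
            M , close = cauchy x η 0<η
        in M , λ m n M≤m M≤n → subst₂ _<_ (cong ∣_∣ (difference m n)) Yε′≡ε
          (∣*∣-bound {Y} {y m} {y n * (x′ n - x′ m)} {ε′} 0<Y (y≤Y m) (subst (∣ y n * (x′ n - x′ m) ∣ <_) Yη≡ε′
            (∣*∣-bound {Y} {y n} {x′ n - x′ m} {η} 0<Y (y≤Y n)
              (close (N ℕ.⊔ n) (N ℕ.⊔ m) (ℕ.≤-trans M≤n (ℕ.m≤n⊔m N n)) (ℕ.≤-trans M≤m (ℕ.m≤n⊔m N m))))))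

-- Tolerance

open import Data.Fin.Subset using (_∈_; _∉_; _─_)
open import Data.Fin.Subset.Properties using (∣⊤∣≡n; p─⊤≡⊥; ∉⊥; x∈p∧x∉q⇒x∈p─q; _∈?_)
open import Data.Integer using (+_)
open import Data.Nat using (NonZero; _≥_)
open import Data.Rational as ℚ using (ℚ; 0ℚ; 1ℚ; mkℚ; _/_; fromℚᵘ; toℚᵘ; ↧ₙ_)
import Data.Rational.Properties as ℚ
import Data.Rational.Unnormalised as ℚᵘ
import Data.Rational.Unnormalised.Properties as ℚᵘ
open RealNumbers
open ≡ using (refl; sym; trans; cong; cong₂; subst)

maximum : ExcludedMiddle 0ℓ → ∀ (P : ℕ → Set) B → (∀ s → P s → s ℕ.≤ B) → ∀ {t} → P t →
          ∃[ s ] P s × (∀ s′ → P s′ → s′ ℕ.≤ s)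
maximum em P B bound {t} Pt with em {P B}
... | yes PB = B , PB , bound
maximum em P zero bound {t} Pt | no ¬P0 = ⊥-elim (¬P0 (subst P (ℕ.n≤0⇒n≡0 (bound t Pt)) Pt))
maximum em P (suc B) bound Pt | no ¬PB = maximum em P B (λ s Ps →
  ℕ.s≤s⁻¹ (ℕ.≤∧≢⇒< (bound s Ps) λ s≡B → ¬PB (subst P s≡B Ps))) Pt

-- `B` serves as fuel: each descent to a smaller element lowers the bound by one, which makes the
-- recursion structural.
minimum : ExcludedMiddle 0ℓ → ∀ (P : ℕ → Set) B {t} → t ℕ.≤ B → P t → ∃[ s ] P s × (∀ s′ → P s′ → s ℕ.≤ s′)
minimum em P B {t} t≤B Pt with em {∃[ s ] s ℕ.< t × P s}
... | no none = t , Pt , λ s Ps → ℕ.≮⇒≥ λ s<t → none (s , s<t , Ps)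
minimum em P zero {t} t≤0 Pt | yes (s , s<t , _) = ⊥-elim (ℕ.<⇒≱ s<t (ℕ.≤-trans t≤0 z≤n))
minimum em P (suc B) t≤B Pt | yes (s , s<t , Ps) = minimum em P B (ℕ.s≤s⁻¹ (ℕ.≤-trans s<t t≤B)) Ps

-- Fractions of natural numbers, computed in the unnormalised rationals

fromℚᵘ-homo-+ : ∀ p q → fromℚᵘ p ℚ.+ fromℚᵘ q ≡ fromℚᵘ (p ℚᵘ.+ q)
fromℚᵘ-homo-+ p q = ℚ.toℚᵘ-injective (ℚᵘ.≃-trans (ℚ.toℚᵘ-homo-+ (fromℚᵘ p) (fromℚᵘ q))
  (ℚᵘ.≃-trans (ℚᵘ.+-cong (ℚ.toℚᵘ-fromℚᵘ p) (ℚ.toℚᵘ-fromℚᵘ q)) (ℚᵘ.≃-sym (ℚ.toℚᵘ-fromℚᵘ (p ℚᵘ.+ q)))))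

fromℚᵘ-homo-* : ∀ p q → fromℚᵘ p ℚ.* fromℚᵘ q ≡ fromℚᵘ (p ℚᵘ.* q)
fromℚᵘ-homo-* p q = ℚ.toℚᵘ-injective (ℚᵘ.≃-trans (ℚ.toℚᵘ-homo-* (fromℚᵘ p) (fromℚᵘ q))
  (ℚᵘ.≃-trans (ℚᵘ.*-cong (ℚ.toℚᵘ-fromℚᵘ p) (ℚ.toℚᵘ-fromℚᵘ q)) (ℚᵘ.≃-sym (ℚ.toℚᵘ-fromℚᵘ (p ℚᵘ.* q)))))

fromℚᵘ-mono-≤ : ∀ {p q} → p ℚᵘ.≤ q → fromℚᵘ p ℚ.≤ fromℚᵘ q
fromℚᵘ-mono-≤ {p} {q} p≤q = ℚ.toℚᵘ-cancel-≤ (begin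
  toℚᵘ (fromℚᵘ p)  ≃⟨ ℚ.toℚᵘ-fromℚᵘ p ⟩
  p                ≤⟨ p≤q ⟩
  q                ≃⟨ ℚ.toℚᵘ-fromℚᵘ q ⟨
  toℚᵘ (fromℚᵘ q)  ∎)
  where open ℚᵘ.≤-Reasoning

ιᵘ : ℕ → ℚᵘ.ℚᵘ
ιᵘ n = ℚᵘ.mkℚᵘ (+ n) 0

ι : ℕ → ℚ
ι n = + n / 1

ι-+ : ∀ m n → ι (m ℕ.+ n) ≡ ι m ℚ.+ ι n
ι-+ m n = sym (trans (fromℚᵘ-homo-+ (ιᵘ m) (ιᵘ n))
  (ℚ.fromℚᵘ-cong {ιᵘ m ℚᵘ.+ ιᵘ n} {ιᵘ (m ℕ.+ n)} (ℚᵘ.*≡* (cong (ℤ._* + 1) (cong₂ ℤ._+_ (ℤ.*-identityʳ (+ m)) (ℤ.*-identityʳ (+ n)))))))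

ι-* : ∀ m n → ι (m ℕ.* n) ≡ ι m ℚ.* ι n
ι-* m n = sym (trans (fromℚᵘ-homo-* (ιᵘ m) (ιᵘ n))
  (ℚ.fromℚᵘ-cong {ιᵘ m ℚᵘ.* ιᵘ n} {ιᵘ (m ℕ.* n)} (ℚᵘ.*≡* (cong (ℤ._* + 1) (sym (ℤ.pos-* m n))))))

ι-mono : ∀ {m n} → m ℕ.≤ n → ι m ℚ.≤ ι n
ι-mono {m} {n} m≤n = fromℚᵘ-mono-≤ {ιᵘ m} {ιᵘ n} (ℚᵘ.*≤* (ℤ.*-monoʳ-≤-nonNeg (+ 1) (ℤ.+≤+ m≤n)))

ι-nonNeg : ∀ n → ℚ.NonNegative (ι n)
ι-nonNeg n = ℚ.nonNegative (ι-mono {0} {n} z≤n)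

ι-injective : ∀ {m n} → ι m ≡ ι n → m ≡ n
ι-injective {m} {n} e with ℚ.fromℚᵘ-injective {ιᵘ m} {ιᵘ n} e
... | ℚᵘ.*≡* h = ℤ.+-injective (trans (sym (ℤ.*-identityʳ (+ m))) (trans h (ℤ.*-identityʳ (+ n))))

/-*-cancel : ∀ n r → + n / suc r ℚ.* ι (suc r) ≡ ι n
/-*-cancel n r = trans (fromℚᵘ-homo-* (ℚᵘ.mkℚᵘ (+ n) r) (ιᵘ (suc r)))
  (ℚ.fromℚᵘ-cong {ℚᵘ.mkℚᵘ (+ n) r ℚᵘ.* ιᵘ (suc r)} {ιᵘ n} (ℚᵘ.*≡* (trans (ℤ.*-identityʳ (+ n ℤ.* + suc r)) (cong (λ k → + n ℤ.* + k) (sym (ℕ.*-identityʳ (suc r)))))))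

-- The product is the numerator, a positive integer. So the reciprocal of the denominator is an
-- error of the form 1/q that does not exceed `p`.
1≤p*denominator : ∀ p → 0ℚ ℚ.< p → 1ℚ ℚ.≤ p ℚ.* ι (↧ₙ p)
1≤p*denominator p@(mkℚ _ _ _) 0<p = begin
  1ℚ                   ≤⟨ numerator p 0<p ⟩
  ℚ.↥ p / 1            ≡⟨ ℚ.fromℚᵘ-cong {ℚᵘ.mkℚᵘ (ℚ.↥ p) 0} {toℚᵘ p ℚᵘ.* ιᵘ (↧ₙ p)} (ℚᵘ.*≡* (trans
                            (cong (λ k → ℚ.↥ p ℤ.* + k) (ℕ.*-identityʳ (↧ₙ p)))
                            (sym (ℤ.*-identityʳ (ℚ.↥ p ℤ.* + ↧ₙ p))))) ⟩
  fromℚᵘ (toℚᵘ p ℚᵘ.* ιᵘ (↧ₙ p))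
                       ≡⟨ fromℚᵘ-homo-* (toℚᵘ p) (ιᵘ (↧ₙ p)) ⟨
  fromℚᵘ (toℚᵘ p) ℚ.* ι (↧ₙ p)
                       ≡⟨ cong (ℚ._* ι (↧ₙ p)) (ℚ.fromℚᵘ-toℚᵘ p) ⟩
  p ℚ.* ι (↧ₙ p)       ∎
  where
    open ℚ.≤-Reasoning
    numerator : ∀ p → 0ℚ ℚ.< p → 1ℚ ℚ.≤ ℚ.↥ p / 1
    numerator (mkℚ (+ suc m) _ _) _ = ι-mono {1} {suc m} (s≤s z≤n)
    numerator (mkℚ (+ zero) _ _) (ℚ.*<* (ℤ.+<+ ()))
    numerator (mkℚ (ℤ.-[1+ m ]) _ _) (ℚ.*<* ())

-- Tolerant partitions and the minimum tolerance

module _ (em : ExcludedMiddle 0ℓ) where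
  open OrderedRing ℝ-commutativeRing (ℝ-positiveCone em) using (NonNeg; sum-zero; 0-not-pos; pos-resp; pos-1)
  open Sarkaria ℝ-commutativeRing (ℝ-positiveCone em) using (CommonPoint; tolerant-colouring)

  nonNeg⇒0≤ᴿ : ∀ x → NonNeg x → 0ᴿ ≤ᴿ x
  nonNeg⇒0≤ᴿ x (inj₁ (δ , 0<δ , p)) ε 0<ε = eventually-map (λ n δ<x → pos+ (ℚ.<-trans 0<δ δ<x) 0<ε) p
  nonNeg⇒0≤ᴿ x (inj₂ x≅0) ε 0<ε = eventually-map (λ n → above (seq x n)) (_≅_.un≅ x≅0 ε 0<ε)
    where
      above : ∀ p → ℚ.∣ p ℚ.- 0ℚ ∣ ℚ.< ε → 0ℚ ℚ.< p ℚ.+ ε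
      above p close = begin-strict
        0ℚ              ≡⟨ ℚ.+-inverseʳ p ⟨
        p ℚ.- p         ≤⟨ ℚ.+-monoʳ-≤ p (p≤∣p∣ (ℚ.- p)) ⟩
        p ℚ.+ ℚ.∣ ℚ.- p ∣  ≡⟨ cong (p ℚ.+_) (trans (ℚ.∣-p∣≡∣p∣ p) (cong ℚ.∣_∣ (sym (ℚ.+-identityʳ p)))) ⟩
        p ℚ.+ ℚ.∣ p ℚ.- 0ℚ ∣  <⟨ ℚ.+-monoʳ-< p close ⟩
        p ℚ.+ ε         ∎
        where open ℚ.≤-Reasoning

  blocks : ∀ {r n} → Vec (Fin r) n → Fin r → Subset n
  blocks χ c = tabulate (λ i → does (lookup χ i Fin.≟ c))

  ∈-blocks⁺ : ∀ {r n} (χ : Vec (Fin r) n) {c} i → lookup χ i ≡ c → i ∈ blocks χ c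
  ∈-blocks⁺ χ {c} i e = lookup⇒[]= i (blocks χ c)
    (trans (lookup∘tabulate _ i) (dec-true (lookup χ i Fin.≟ c) e))

  ∈-blocks⁻ : ∀ {r n} (χ : Vec (Fin r) n) {c} i → i ∈ blocks χ c → lookup χ i ≡ c
  ∈-blocks⁻ χ {c} i i∈ with lookup χ i Fin.≟ c | trans (sym (lookup∘tabulate (λ i → does (lookup χ i Fin.≟ c)) i)) ([]=⇒lookup i∈)
  ... | yes e | _ = e
  ... | no _ | ()

  blocks-partition : ∀ {r n} (χ : Vec (Fin r) n) → IsPartition (blocks χ)
  blocks-partition χ = record
    { covers = λ i → lookup χ i , ∈-blocks⁺ χ i refl
    ; disjoint = λ {i} p q → trans (sym (∈-blocks⁻ χ i p)) (∈-blocks⁻ χ i q) }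

  commonPoint⇒conv : ∀ {r n d} (X : PointSet n d) (χ : Vec (Fin r) n) Y → CommonPoint (lookup χ) (point X) (∁ Y) →
    Σ[ p ∈ Point d ] (∀ c → p ∈conv[ X , blocks χ c ─ Y ])
  commonPoint⇒conv X χ Y cp = centre , λ c → record
    { weight = weight c
    ; weight≥0 = λ i → nonNeg⇒0≤ᴿ (weight c i) (nonNeg c i)
    ; supported = λ i i∉ → _≅_.un≅ (vanishes c i i∉)
    ; total = _≅_.un≅ (total c)
    ; combination = λ k → _≅_.un≅ (combined c k) }
    where
      open CommonPoint cp
      vanishes : ∀ c i → i ∉ blocks χ c ─ Y → weight c i ≅ 0ᴿ
      vanishes c i i∉ with lookup χ i Fin.≟ c | i ∈? Y
      ... | no χi≢c | _ = foreign c i χi≢c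
      ... | yes _ | yes i∈Y = inactive c i (trans (lookup-map i not Y) (cong not ([]=⇒lookup i∈Y)))
      ... | yes χi≡c | no i∉Y = ⊥-elim (i∉ (x∈p∧x∉q⇒x∈p─q (∈-blocks⁺ χ i χi≡c) i∉Y))

  tolerates : ∀ r′ d L → ∃[ n₀ ] (∀ n → n ≥ n₀ → ∀ t →
    L ℕ.* suc r′ ℕ.* t ℕ.+ suc r′ ℕ.* n ℕ.< L ℕ.* n → ∀ (X : PointSet n d) → Tolerates X (suc r′) t)
  tolerates r′ d L =
    let n₀ , colour = tolerant-colouring em ℝ-inverse r′ d L in
    n₀ , λ n n≥n₀ t few X →
      let χ , common = colour n n≥n₀ (point X) in
      blocks χ , blocks-partition χ , λ Y |Y|≤t → commonPoint⇒conv X χ Y (common Y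
        (ℕ.≤-<-trans (ℕ.+-monoˡ-≤ (suc r′ ℕ.* n) (ℕ.*-monoʳ-≤ (L ℕ.* suc r′) |Y|≤t)) few))

  -- Deleting all points leaves class `zero` empty, and a point in its hull would have weights with
  -- sum both 0 and 1. This is the bound that makes the maximum in the tolerance exist.
  tolerates⇒≤ : ∀ {n d r} (X : PointSet n d) s → Tolerates X (suc r) s → s ℕ.≤ n
  tolerates⇒≤ {n} X s (A , _ , tol) = ℕ.≮⇒≥ λ n<s →
    empty-hull (proj₂ (tol ⊤ (ℕ.≤-trans (ℕ.≤-reflexive (∣⊤∣≡n n)) (ℕ.<⇒≤ n<s))) zero)
    where
      empty-hull : ∀ {p} → ¬ p ∈conv[ X , A zero ─ ⊤ ]
      empty-hull hull = 0-not-pos (pos-resp 1≅0 pos-1)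
        where
          open _∈conv[_,_] hull
          module R = CommutativeRing ℝ-commutativeRing
          1≅0 : 1ᴿ ≅ 0ᴿ
          1≅0 = R.trans (R.sym (mk≅ total))
            (sum-zero (λ i → mk≅ (supported i (λ i∈ → ∉⊥ (subst (i ∈_) (p─⊤≡⊥ (A zero)) i∈)))))

  tolerance : ∀ {n d r t} (X : PointSet n d) → Tolerates X (suc r) t → ∃[ s ] IsTolerance X (suc r) s × t ℕ.≤ s
  tolerance {n} X tol =
    let s , tol-s , max = maximum em (Tolerates X _) n (tolerates⇒≤ X) tol in s , (tol-s , max) , max _ tol

  -- The minimum over point sets needs one set to start from. The points lie on the diagonal, and
  -- the positive dimension provides the coordinate that tells them apart.
  line : ∀ n d → PointSet n (suc d)
  line n d = record
    { point = λ i _ → fromℕ (toℕ i)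
    ; distinct = λ {i} {j} e → toℕ-injective (ι-injective (constant-≡ (e zero))) }
    where
      constant-≡ : ∀ {p q} → fromℚ p ≈ᴿ fromℚ q → p ≡ q
      constant-≡ {p} {q} e with p ℚ.≟ q
      ... | yes p≡q = p≡q
      ... | no p≢q = ⊥-elim (ℚ.<-irrefl refl (proj₂ close (proj₁ close) ℕ.≤-refl))
        where
          0<∣p-q∣ : 0ℚ ℚ.< ℚ.∣ p ℚ.- q ∣
          0<∣p-q∣ = ℚ.≰⇒> λ ∣p-q∣≤0 → p≢q (p-q≡0⇒p≡q (ℚ.∣p∣≡0⇒p≡0 (p ℚ.- q) (ℚ.≤-antisym ∣p-q∣≤0 (ℚ.0≤∣p∣ _))))
            where
              p-q≡0⇒p≡q : p ℚ.- q ≡ 0ℚ → p ≡ q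
              p-q≡0⇒p≡q h = trans (sym (ℚ.+-identityʳ p)) (trans (cong (p ℚ.+_) (sym (ℚ.+-inverseˡ q)))
                (trans (sym (ℚ.+-assoc p (ℚ.- q) q)) (trans (cong (ℚ._+ q) h) (ℚ.+-identityˡ q))))
          close = e ℚ.∣ p ℚ.- q ∣ 0<∣p-q∣

  minTolerance : ∀ {n d r t₀} → (∀ (X : PointSet n (suc d)) → Tolerates X (suc r) t₀) →
    ∃[ t ] IsMinTolerance n (suc d) (suc r) t × t₀ ℕ.≤ t
  minTolerance {n} {d} {r} {t₀} tol =
    let s , is-s , _ = tolerance (line n d) (tol (line n d))
        t , (X , is-t) , min = minimum em (λ s → Σ[ X ∈ PointSet n (suc d) ] IsTolerance X (suc r) s) s ℕ.≤-refl (line n d , is-s)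
    in t , ((λ X → let s , is-s , _ = tolerance X (tol X) in s , is-s , min s (X , is-s)) , (X , is-t)) ,
       proj₂ is-t t₀ (tol X)

-- With L = 2 q r, the largest admissible t is at least n / r - n / L - 1 ≥ n / r - n / q once n ≥ L.
tolerance-choice : ∀ r′ q′ n → let r = suc r′; q = suc q′; L = 2 ℕ.* q ℕ.* r in L ℕ.≤ n →
  ∃[ t₀ ] L ℕ.* r ℕ.* t₀ ℕ.+ r ℕ.* n ℕ.< L ℕ.* n × (∀ t → t₀ ℕ.≤ t → q ℕ.* n ℕ.≤ r ℕ.* q ℕ.* t ℕ.+ r ℕ.* n)
tolerance-choice r′ q′ n L≤n = t₀ , admissible , enough
  where
    open ℕ.≤-Reasoning
    r = suc r′
    q = suc q′
    -- The loss consists of n/L from the balance and 1 from rounding. As 1 ≤ n/L, it is at most 2n/L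
    -- = n/(q r), within the allowed n/q.
    L = 2 ℕ.* q ℕ.* r
    -- The `suc` makes the inequality of `admissible` strict after division with remainder.
    m = L ℕ.* n ℕ.∸ suc (r ℕ.* n)
    t₀ = m ℕ./ (L ℕ.* r)

    slack : suc (r ℕ.* n) ℕ.≤ L ℕ.* n
    slack = begin
      1 ℕ.+ r ℕ.* n                  ≤⟨ ℕ.+-monoˡ-≤ (r ℕ.* n) (ℕ.*-mono-≤ {1} {r} {1} {n} (s≤s z≤n) (ℕ.≤-trans (s≤s z≤n) L≤n)) ⟩
      r ℕ.* n ℕ.+ r ℕ.* n            ≤⟨ ℕ.m≤m+n _ (2 ℕ.* q′ ℕ.* r ℕ.* n) ⟩
      r ℕ.* n ℕ.+ r ℕ.* n ℕ.+ 2 ℕ.* q′ ℕ.* r ℕ.* n  ≡⟨ e q′ r n ⟩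
      L ℕ.* n                        ∎
      where
        e : ∀ q r n → r ℕ.* n ℕ.+ r ℕ.* n ℕ.+ 2 ℕ.* q ℕ.* r ℕ.* n ≡ 2 ℕ.* suc q ℕ.* r ℕ.* n
        e = solve-∀

    admissible : L ℕ.* r ℕ.* t₀ ℕ.+ r ℕ.* n ℕ.< L ℕ.* n
    admissible = begin-strict
      L ℕ.* r ℕ.* t₀ ℕ.+ r ℕ.* n     ≡⟨ cong (ℕ._+ r ℕ.* n) (ℕ.*-comm (L ℕ.* r) t₀) ⟩
      t₀ ℕ.* (L ℕ.* r) ℕ.+ r ℕ.* n   ≤⟨ ℕ.+-monoˡ-≤ (r ℕ.* n) (ℕ.m/n*n≤m m (L ℕ.* r)) ⟩
      m ℕ.+ r ℕ.* n                  <⟨ ℕ.+-monoʳ-< m (ℕ.n<1+n (r ℕ.* n)) ⟩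
      m ℕ.+ suc (r ℕ.* n)            ≡⟨ ℕ.m∸n+n≡m slack ⟩
      L ℕ.* n                        ∎

    maximal : L ℕ.* n ℕ.≤ L ℕ.* r ℕ.* suc t₀ ℕ.+ r ℕ.* n
    maximal = begin
      L ℕ.* n                        ≡⟨ ℕ.m∸n+n≡m slack ⟨
      m ℕ.+ suc (r ℕ.* n)            ≡⟨ ℕ.+-suc m (r ℕ.* n) ⟩
      suc m ℕ.+ r ℕ.* n              ≤⟨ ℕ.+-monoˡ-≤ (r ℕ.* n) m<Lr[t₀+1] ⟩
      L ℕ.* r ℕ.* suc t₀ ℕ.+ r ℕ.* n ∎
      where
        m<Lr[t₀+1] : m ℕ.< L ℕ.* r ℕ.* suc t₀
        m<Lr[t₀+1] = begin-strict
          m                                              ≡⟨ ℕ.m≡m%n+[m/n]*n m (L ℕ.* r) ⟩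
          m ℕ.% (L ℕ.* r) ℕ.+ t₀ ℕ.* (L ℕ.* r)           <⟨ ℕ.+-monoˡ-< (t₀ ℕ.* (L ℕ.* r)) (ℕ.m%n<n m (L ℕ.* r)) ⟩
          suc t₀ ℕ.* (L ℕ.* r)                           ≡⟨ ℕ.*-comm (suc t₀) (L ℕ.* r) ⟩
          L ℕ.* r ℕ.* suc t₀                             ∎

    enough : ∀ t → t₀ ℕ.≤ t → q ℕ.* n ℕ.≤ r ℕ.* q ℕ.* t ℕ.+ r ℕ.* n
    enough t t₀≤t = ℕ.*-cancelˡ-≤ (2 ℕ.* r) (begin
      2 ℕ.* r ℕ.* (q ℕ.* n)                             ≡⟨ e₁ r q n ⟩
      L ℕ.* n                                           ≤⟨ maximal ⟩
      L ℕ.* r ℕ.* suc t₀ ℕ.+ r ℕ.* n                    ≤⟨ ℕ.+-monoˡ-≤ (r ℕ.* n) (ℕ.*-monoʳ-≤ (L ℕ.* r) (s≤s t₀≤t)) ⟩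
      L ℕ.* r ℕ.* suc t ℕ.+ r ℕ.* n                     ≡⟨ e₂ L r t n ⟩
      L ℕ.* r ℕ.* t ℕ.+ r ℕ.* (L ℕ.+ n)                 ≤⟨ ℕ.+-monoʳ-≤ (L ℕ.* r ℕ.* t) (ℕ.*-monoʳ-≤ r (ℕ.+-monoˡ-≤ n L≤n)) ⟩
      L ℕ.* r ℕ.* t ℕ.+ r ℕ.* (n ℕ.+ n)                 ≤⟨ ℕ.m≤m+n _ (r′ ℕ.* (r ℕ.* (n ℕ.+ n))) ⟩
      L ℕ.* r ℕ.* t ℕ.+ r ℕ.* (n ℕ.+ n) ℕ.+ r′ ℕ.* (r ℕ.* (n ℕ.+ n))   ≡⟨ e₃ r′ q t n ⟩
      2 ℕ.* r ℕ.* (r ℕ.* q ℕ.* t ℕ.+ r ℕ.* n)           ∎)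
      where
        e₁ : ∀ r q n → 2 ℕ.* r ℕ.* (q ℕ.* n) ≡ 2 ℕ.* q ℕ.* r ℕ.* n
        e₁ = solve-∀
        e₂ : ∀ L r t n → L ℕ.* r ℕ.* suc t ℕ.+ r ℕ.* n ≡ L ℕ.* r ℕ.* t ℕ.+ r ℕ.* (L ℕ.+ n)
        e₂ = solve-∀
        e₃ : ∀ r′ q t n → 2 ℕ.* q ℕ.* suc r′ ℕ.* suc r′ ℕ.* t ℕ.+ suc r′ ℕ.* (n ℕ.+ n) ℕ.+ r′ ℕ.* (suc r′ ℕ.* (n ℕ.+ n)) ≡
             2 ℕ.* suc r′ ℕ.* (suc r′ ℕ.* q ℕ.* t ℕ.+ suc r′ ℕ.* n)
        e₃ = solve-∀

open IntegerSolver ℚ.+-*-commutativeRing using (solve; _:+_; _:*_; _:-_; :-_; _:=_)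

-- Multiplying by `r * q` clears the fraction; the hypothesis on `δ` then turns the error `r * n`
-- into `δ * n` times that factor.
n/r≤t+δn : ∀ n r′ q t δ → 0 ℕ.< q → 1ℚ ℚ.≤ δ ℚ.* ι q → q ℕ.* n ℕ.≤ suc r′ ℕ.* q ℕ.* t ℕ.+ suc r′ ℕ.* n →
  + n / suc r′ ℚ.≤ ι t ℚ.+ δ ℚ.* ι n
n/r≤t+δn n r′ q t δ 0<q 1≤δq bound = ℚ.*-cancelʳ-≤-pos (ι r ℚ.* ι q) {{ℚ.positive (pos* 0<ιr 0<ιq)}} (begin
  + n / r ℚ.* (ι r ℚ.* ι q)                        ≡⟨ ℚ.*-assoc (+ n / r) (ι r) (ι q) ⟨
  + n / r ℚ.* ι r ℚ.* ι q                          ≡⟨ cong (ℚ._* ι q) (/-*-cancel n r′) ⟩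
  ι n ℚ.* ι q                                      ≡⟨ trans (ℚ.*-comm (ι n) (ι q)) (sym (ι-* q n)) ⟩
  ι (q ℕ.* n)                                      ≤⟨ ι-mono {q ℕ.* n} {r ℕ.* q ℕ.* t ℕ.+ r ℕ.* n} bound ⟩
  ι (r ℕ.* q ℕ.* t ℕ.+ r ℕ.* n)                    ≡⟨ ι-+ (r ℕ.* q ℕ.* t) (r ℕ.* n) ⟩
  ι (r ℕ.* q ℕ.* t) ℚ.+ ι (r ℕ.* n)                ≡⟨ cong₂ ℚ._+_ (trans (ι-* (r ℕ.* q) t) (cong (ℚ._* ι t) (ι-* r q)))
                                                        (sym (ℚ.*-identityʳ (ι (r ℕ.* n)))) ⟩
  ι r ℚ.* ι q ℚ.* ι t ℚ.+ ι (r ℕ.* n) ℚ.* 1ℚ       ≤⟨ ℚ.+-monoʳ-≤ (ι r ℚ.* ι q ℚ.* ι t)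
                                                        (ℚ.*-monoˡ-≤-nonNeg (ι (r ℕ.* n)) {{ι-nonNeg (r ℕ.* n)}} 1≤δq) ⟩
  ι r ℚ.* ι q ℚ.* ι t ℚ.+ ι (r ℕ.* n) ℚ.* (δ ℚ.* ι q)
                                                   ≡⟨ cong (λ x → ι r ℚ.* ι q ℚ.* ι t ℚ.+ x ℚ.* (δ ℚ.* ι q)) (ι-* r n) ⟩
  ι r ℚ.* ι q ℚ.* ι t ℚ.+ ι r ℚ.* ι n ℚ.* (δ ℚ.* ι q)
                                                   ≡⟨ rearrange (ι r) (ι q) (ι t) (ι n) δ ⟩
  (ι t ℚ.+ δ ℚ.* ι n) ℚ.* (ι r ℚ.* ι q)            ∎)
  where
    open ℚ.≤-Reasoning
    r = suc r′
    0<ι : ∀ {m} → 0 ℕ.< m → 0ℚ ℚ.< ι m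
    0<ι {m} 0<m = ℚ.<-≤-trans 0<1 (ι-mono {1} {m} 0<m)
    0<ιr = 0<ι {r} (s≤s z≤n)
    0<ιq = 0<ι {q} 0<q
    rearrange : ∀ r q t n δ → r ℚ.* q ℚ.* t ℚ.+ r ℚ.* n ℚ.* (δ ℚ.* q) ≡ (t ℚ.+ δ ℚ.* n) ℚ.* (r ℚ.* q)
    rearrange = solve 5 (λ r q t n δ → r :* q :* t :+ r :* n :* (δ :* q) := (t :+ δ :* n) :* (r :* q)) refl

-- The bound is known for the rational `δ`, and the late terms of `ε` exceed `δ`; the order on the
-- reals asks only for late terms.
final-bound : ∀ (ε : ℝ) n r′ t δ → (Eventually λ m → 0ℚ ℚ.+ δ ℚ.< seq ε m) → + n / suc r′ ℚ.≤ ι t ℚ.+ δ ℚ.* ι n →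
  fromℚ (+ n / suc r′) -ᴿ ε *ᴿ fromℕ n ≤ᴿ fromℕ t
final-bound ε n r′ t δ δ<ε bound η 0<η = eventually-map below δ<ε
  where
    open ℚ.≤-Reasoning
    below : ∀ m → 0ℚ ℚ.+ δ ℚ.< seq ε m → + n / suc r′ ℚ.- seq ε m ℚ.* ι n ℚ.< ι t ℚ.+ η
    below m δ<εm = begin-strict
      + n / suc r′ ℚ.- seq ε m ℚ.* ι n                   ≤⟨ ℚ.+-monoˡ-≤ (ℚ.- (seq ε m ℚ.* ι n)) bound ⟩
      ι t ℚ.+ δ ℚ.* ι n ℚ.- seq ε m ℚ.* ι n              ≤⟨ ℚ.+-monoˡ-≤ (ℚ.- (seq ε m ℚ.* ι n)) (ℚ.+-monoʳ-≤ (ι t)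
                                                              (ℚ.*-monoʳ-≤-nonNeg (ι n) {{ι-nonNeg n}} δ≤εm)) ⟩
      ι t ℚ.+ seq ε m ℚ.* ι n ℚ.- seq ε m ℚ.* ι n        ≡⟨ solve 2 (λ a b → a :+ b :- b := a) refl (ι t) (seq ε m ℚ.* ι n) ⟩
      ι t                                                ≡⟨ ℚ.+-identityʳ (ι t) ⟨
      ι t ℚ.+ 0ℚ                                         <⟨ ℚ.+-monoʳ-< (ι t) 0<η ⟩
      ι t ℚ.+ η                                          ∎
      where
        δ≤εm : δ ℚ.≤ seq ε m
        δ≤εm = ℚ.<⇒≤ (subst (ℚ._< seq ε m) (ℚ.+-identityˡ δ) δ<εm)

lemma3p6 : ExcludedMiddle 0ℓ →
    (r d : ℕ) .{{_ : NonZero r}} .{{_ : NonZero d}} →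
    (ε : ℝ) → 0ᴿ <ᴿ ε →
    ∃[ n₀ ] (∀ n → n ≥ n₀ →
    ∃[ t ] (IsMinTolerance n d r t ×
    fromℚ (+ n / r) -ᴿ ε *ᴿ fromℕ n ≤ᴿ fromℕ t))
lemma3p6 em zero d {{r≢0}} = ⊥-elim (ℕ.≢-nonZero⁻¹ 0 {{r≢0}} refl)
lemma3p6 em (suc r′) zero {{_}} {{d≢0}} = ⊥-elim (ℕ.≢-nonZero⁻¹ 0 {{d≢0}} refl)
lemma3p6 em (suc r′) (suc d′) ε (δ , 0<δ , δ<ε) =
  -- `δ` is the rational margin contained in `0ᴿ <ᴿ ε`, and its denominator plays the part of `q`.
  -- The maximum with `L` in the threshold pays for rounding.
  let L = 2 ℕ.* ↧ₙ δ ℕ.* suc r′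
      n₀ , tol = tolerates em r′ (suc d′) L
  in n₀ ℕ.⊔ L , λ n n≥ →
    let t₀ , admissible , enough = tolerance-choice r′ (ℚ.denominator-1 δ) n (ℕ.m⊔n≤o⇒n≤o n₀ L n≥)
        t , isMin , t₀≤t = minTolerance em (tol n (ℕ.m⊔n≤o⇒m≤o n₀ L n≥) t₀ admissible)
    in t , isMin , final-bound ε n r′ t δ δ<ε
         (n/r≤t+δn n r′ (↧ₙ δ) t δ (s≤s z≤n) (1≤p*denominator δ 0<δ) (enough t t₀≤t))
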